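{- Let $p$ be an odd prime, $n\ge4$, $2\le m\le n-2$, $r=n-m$, and let $I$ be the saturated generalized order ideal of $\mathbb{GH}(m,n)$ in which every element of $[n]$ has multiplicity $p-1$. Let $f:\mathbb{F}_p^n\to\mathbb{F}_p$ be the characteristic function of $I(\mathbb{GP})\setminus\{0\}$ (saturated notion) and \[ \mathcal{C}_f=\{c(s,u)=(sf(x)+u\cdot x)_{x\in\mathbb{F}_p^n\setminus0}:\ s\in\mathbb{F}_p,\ u\in\mathbb{F}_p^n\}. \] Then $\mathcal{C}_f$ is a minimal $[p^n-1,\ n+1,\ p^m+p^r-2]$ code over $\mathbb{F}_p$ with at most seven nonzero weights, it violates the Ashikhmin--Barg condition, and its weight distribution is, with $Q=(p-1)p^{n-1}$ (frequencies being added for rows with equal weight), \[ \begin{array}{ll} \text{weight} & \text{frequency}\\ p^m+p^r-2 & p-1\\ Q-p^r & (p-1)p^{m-1}\\ Q-2 & (p-1)(p^{m-1}-1)(p^r-1)\\ Q-1 & (p-1)(p-2)p^{n-1}\\ Q & p^n-1+(p-1)p^{m-1}(p^r-1)\\ Q+p^m-2 & (p-1)(p^r-1)\\ Q+p^r-2 & (p-1)(p^{m-1}-1) \end{array} \]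
   Context: $[n]=\{1,\dots,n\}$; $u\cdot x=\sum_i u_ix_i$. An $[N,k,d]$ code is a linear code of length $N$, dimension $k$, minimum Hamming distance $d$. A nonzero codeword $c$ of a linear code $\mathcal{C}$ over $\mathbb{F}_p$ is minimal if $c'\in\mathcal{C}$ and $\mathrm{supp}(c')\subseteq\mathrm{supp}(c)$ imply $c'\in\mathbb{F}_pc$; $\mathcal{C}$ is minimal if all its nonzero codewords are. The Ashikhmin--Barg condition is $w_{\min}/w_{\max}>(p-1)/p$, where $w_{\min},w_{\max}$ are the smallest and largest nonzero weights; a code violates it if the inequality fails. Generalized order ideals: $[n]_{p-1}$ is the multiset in which each $i\in[n]$ has multiplicity $p-1$. A sub-multiset $J$ is identified with its multiplicity vector $(J_1,\dots,J_n)\in\{0,\dots,p-1\}^n=\mathbb{F}_p^n$; $J\subseteq J'$ means $J_i\le J'_i$ (as integers) for all $i$; $\bar J=\{i:J_i\ne0\}$. The hierarchical poset $\mathbb{H}(m,n)$ on $[n]$ has as its only strict relations $i\prec j$ for all $i\in[m]$, $j\in[n]\setminus[m]$; $\mathbb{GH}(m,n)$ denotes $[n]_{p-1}$ together with this order. $J$ is a saturated generalized order ideal if $\bar J$ is an order ideal (down-closed subset) of $\mathbb{H}(m,n)$ and $J_i=p-1$ whenever $j\in\bar J$ and $i\prec j$. For a saturated generalized order ideal $I$, $I(\mathbb{GP})\subseteq\mathbb{F}_p^n$ is the set of all saturated generalized order ideals contained in $I$. Thus for the $I$ considered here, $I(\mathbb{GP})=(\mathbb{F}_p^m\times0)\cup(\{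 -1\}^m\times(\mathbb{F}_p^{r}\setminus0))$. -}

module Defs where

open import Data.Bool.Base using (if_then_else_; not)
open import Data.Fin.Base using (Fin; toℕ)
import Data.Fin.Properties as Fin
open import Data.Fin.Subset using (Subset; ∣_∣) renaming (_∈_ to _∈ₛ_; _⊆_ to _⊆ₛ_)
open import Data.Fin.Subset.Properties using (_∈?_)
open import Data.Integer.Base using (+_)
open import Data.List.Base as List using (List; []; _∷_; length; filter; allFin; cartesianProductWith)
open import Data.List.Membership.Propositional using () renaming (_∈_ to _∈ₗ_)
open import Data.List.Relation.Unary.Unique.Propositional using (Unique)
open import Data.Nat.Base as ℕ using (ℕ; zero; suc; _∸_; _≤_; NonZero)
open import Data.Nat.DivMod using (_mod_)
open import Data.Nat.ListAction using (sum)
import Data.Nat.Properties as ℕ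
open import Data.Product.Base using (Σ; ∃; ∃₂; _×_; _,_; proj₁; proj₂)
open import Data.Rational.Unnormalised.Base as ℚᵘ using (_/_)
open import Data.Vec.Base as Vec using (Vec; []; _∷_; lookup; replicate; zipWith; foldr′; fromList)
open import Data.Vec.Properties using (≡-dec)
open import Data.Vec.Relation.Unary.All using (All)
open import Function.Bundles using (_⇔_)
open import Level using (0ℓ)
open import Relation.Binary.Core using (Rel)
import Relation.Binary.Definitions as B
open import Relation.Binary.PropositionalEquality.Core using (_≡_; _≢_)
open import Relation.Nullary.Decidable.Core using (does; ¬?; _×-dec_; _→-dec_)
open import Relation.Nullary.Negation.Core using (¬_)
open import Relation.Unary using (Pred; Decidable; _∈_)

-- The field with p elements; the residues are represented by 0, …, p - 1,
-- so that `toℕ` reads a residue as an integer multiplicity.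
𝔽 : ℕ → Set
𝔽 = Fin

module _ {p : ℕ} .{{_ : NonZero p}} where

  infixl 6 _+ᶠ_ _+ᵛ_
  infixl 7 _*ᶠ_ _∙_ _*ᵛ_

  [_]ᶠ : ℕ → 𝔽 p
  [ k ]ᶠ = k mod p

  0ᶠ 1ᶠ : 𝔽 p
  0ᶠ = [ 0 ]ᶠ
  1ᶠ = [ 1 ]ᶠ

  _+ᶠ_ _*ᶠ_ : 𝔽 p → 𝔽 p → 𝔽 p
  a +ᶠ b = [ toℕ a ℕ.+ toℕ b ]ᶠ
  a *ᶠ b = [ toℕ a ℕ.* toℕ b ]ᶠ

  0ᵛ : ∀ {n} → Vec (𝔽 p) n
  0ᵛ = replicate _ 0ᶠ

  _+ᵛ_ : ∀ {n} → Vec (𝔽 p) n → Vec (𝔽 p) n → Vec (𝔽 p) n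
  _+ᵛ_ = zipWith _+ᶠ_

  _*ᵛ_ : ∀ {n} → 𝔽 p → Vec (𝔽 p) n → Vec (𝔽 p) n
  a *ᵛ x = Vec.map (a *ᶠ_) x

  _∙_ : ∀ {n} → Vec (𝔽 p) n → Vec (𝔽 p) n → 𝔽 p
  u ∙ x = foldr′ _+ᶠ_ 0ᶠ (zipWith _*ᶠ_ u x)

  combination : ∀ {k n} → Vec (𝔽 p) k → Vec (Vec (𝔽 p) n) k → Vec (𝔽 p) n
  combination a b = foldr′ _+ᵛ_ 0ᵛ (zipWith _*ᵛ_ a b)

  Nonzero : ∀ {n} → Pred (Vec (𝔽 p) n) 0ℓ
  Nonzero x = x ≢ 0ᵛ

  nonzero? : ∀ {n} → Decidable (Nonzero {n})
  nonzero? x = ¬? (≡-dec Fin._≟_ x 0ᵛ)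

  supp : ∀ {n} → Vec (𝔽 p) n → Subset n
  supp = Vec.map (λ a → not (does (a Fin.≟ 0ᶠ)))

  χ : ∀ {n} {P : Pred (Vec (𝔽 p) n) 0ℓ} → Decidable P → Vec (𝔽 p) n → 𝔽 p
  χ P? x = if does (P? x) then 1ᶠ else 0ᶠ

-- `HasCard P k`: the set P has exactly k elements.
HasCard : {A : Set} → Pred A 0ℓ → ℕ → Set
HasCard {A} P k = Σ (List A) λ xs →
  Unique xs × (∀ x → (x ∈ₗ xs) ⇔ (x ∈ P)) × length xs ≡ k

------------------------------------------------------------------------
-- Linear codes

module _ {p : ℕ} .{{_ : NonZero p}} where

  Code : ℕ → Set₁
  Code L = Pred (Vec (𝔽 p) L) 0ℓ

  wt : ∀ {L} → Vec (𝔽 p) L → ℕ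
  wt c = ∣ supp c ∣

  dist : ∀ {L} → Vec (𝔽 p) L → Vec (𝔽 p) L → ℕ
  dist c c′ = ∣ zipWith (λ a b → not (does (a Fin.≟ b))) c c′ ∣

  record IsLinear {L} (C : Code L) : Set where
    field
      0-closed : 0ᵛ ∈ C
      +-closed : ∀ {c c′} → c ∈ C → c′ ∈ C → c +ᵛ c′ ∈ C
      *-closed : ∀ a {c} → c ∈ C → a *ᵛ c ∈ C

  record HasDimension {L} (C : Code L) (k : ℕ) : Set where
    field
      basis       : Vec (Vec (𝔽 p) L) k
      inside      : All C basis
      independent : ∀ a → combination a basis ≡ 0ᵛ → a ≡ 0ᵛ
      spanning    : ∀ {c} → c ∈ C → ∃ λ a → c ≡ combination a basis

  record HasMinDistance {L} (C : Code L) (d : ℕ) : Set where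
    field
      attained : ∃₂ λ c c′ → c ∈ C × c′ ∈ C × c ≢ c′ × dist c c′ ≡ d
      bound    : ∀ {c c′} → c ∈ C → c′ ∈ C → c ≢ c′ → d ≤ dist c c′

  record Is[_,_,_]Code (N k d : ℕ) {L} (C : Code L) : Set where
    field
      hasLength   : L ≡ N
      linear      : IsLinear C
      dimension   : HasDimension C k
      minDistance : HasMinDistance C d

  record IsMinimalCodeword {L} (C : Code L) (c : Vec (𝔽 p) L) : Set where
    field
      codeword : c ∈ C
      nonzero  : Nonzero c
      minimal  : ∀ {c′} → c′ ∈ C → supp c′ ⊆ₛ supp c → ∃ λ a → c′ ≡ a *ᵛ c

  IsMinimal : ∀ {L} → Code L → Set
  IsMinimal C = ∀ {c} → c ∈ C → Nonzero c → IsMinimalCodeword C c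

  NonzeroWeight : ∀ {L} → Code L → Pred ℕ 0ℓ
  NonzeroWeight C w = w ≢ 0 × ∃ λ c → c ∈ C × wt c ≡ w

  AtMostNonzeroWeights : ∀ {L} → ℕ → Code L → Set
  AtMostNonzeroWeights b C = ∃ λ k → HasCard (NonzeroWeight C) k × k ≤ b

  record ViolatesAshikhminBarg {L} (C : Code L) : Set where
    field
      w-min w-max     : ℕ
      {{w-max-nonZero}} : NonZero w-max
      isMin : NonzeroWeight C w-min × (∀ {w} → w ∈ NonzeroWeight C → w-min ≤ w)
      isMax : NonzeroWeight C w-max × (∀ {w} → w ∈ NonzeroWeight C → w ≤ w-max)
      fails : ¬ ((+ w-min / w-max) ℚᵘ.> (+ (p ∸ 1) / p))

  -- Rows are pairs (weight , frequency).
  frequency : List (ℕ × ℕ) → ℕ → ℕ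
  frequency rows w = sum (List.map proj₂ (filter (λ row → proj₁ row ℕ.≟ w) rows))

  -- The table describes the nonzero codewords only; a weight that is listed in
  -- no row has frequency 0.
  HasWeightDistribution : ∀ {L} → Code L → List (ℕ × ℕ) → Set
  HasWeightDistribution C rows =
    ∀ w → HasCard (λ c → c ∈ C × Nonzero c × wt c ≡ w) (frequency rows w)

------------------------------------------------------------------------
-- Saturated generalized order ideals

-- Positions are numbered from 0, so toℕ i < m says that i is one of the
-- first m elements.
Hierarchical : ∀ m n → Rel (Fin n) 0ℓ
Hierarchical m n i j = toℕ i ℕ.< m × m ≤ toℕ j

hierarchical? : ∀ m n → B.Decidable (Hierarchical m n)
hierarchical? m n i j = (toℕ i ℕ.<? m) ×-dec (m ℕ.≤? toℕ j)

IsOrderIdeal : ∀ {n} → Rel (Fin n) 0ℓ → Subset n → Set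
IsOrderIdeal _≺_ A = ∀ j i → j ∈ₛ A → i ≺ j → i ∈ₛ A

module _ {p : ℕ} .{{_ : NonZero p}} {n : ℕ} where

  infix 4 _⊆ᵐ_

  _⊆ᵐ_ : Rel (Vec (𝔽 p) n) 0ℓ
  J ⊆ᵐ J′ = ∀ i → toℕ (lookup J i) ≤ toℕ (lookup J′ i)

  IsSaturatedIdeal : Rel (Fin n) 0ℓ → Pred (Vec (𝔽 p) n) 0ℓ
  IsSaturatedIdeal _≺_ J =
    IsOrderIdeal _≺_ (supp J) ×
    (∀ j i → j ∈ₛ supp J → i ≺ j → toℕ (lookup J i) ≡ p ∸ 1)

  -- I(𝔾ℙ), for the order _≺_
  SaturatedIdealsIn : Rel (Fin n) 0ℓ → Vec (𝔽 p) n → Pred (Vec (𝔽 p) n) 0ℓ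
  SaturatedIdealsIn _≺_ I J = IsSaturatedIdeal _≺_ J × J ⊆ᵐ I

  saturatedIdealsIn? : ∀ {_≺_} → B.Decidable _≺_ → ∀ I → Decidable (SaturatedIdealsIn _≺_ I)
  saturatedIdealsIn? _≺?_ I J =
    (Fin.all? (λ j → Fin.all? λ i →
        (j ∈? supp J) →-dec ((i ≺? j) →-dec (i ∈? supp J)))
     ×-dec
     Fin.all? (λ j → Fin.all? λ i →
        (j ∈? supp J) →-dec ((i ≺? j) →-dec (toℕ (lookup J i) ℕ.≟ p ∸ 1))))
    ×-dec Fin.all? (λ i → toℕ (lookup J i) ℕ.≤? toℕ (lookup I i))

fullMultiset : ∀ p n .{{_ : NonZero p}} → Vec (𝔽 p) n
fullMultiset p n = replicate n [ p ∸ 1 ]ᶠ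

------------------------------------------------------------------------
-- The code of a function

allVecs : ∀ p n → List (Vec (𝔽 p) n)
allVecs p zero    = [] ∷ []
allVecs p (suc n) = cartesianProductWith _∷_ (allFin p) (allVecs p n)

-- The coordinates of the code: 𝔽ₚⁿ∖0 in lexicographic order.
nonzeroVecs : ∀ p n .{{_ : NonZero p}} → List (Vec (𝔽 p) n)
nonzeroVecs p n = filter nonzero? (allVecs p n)

module _ {p : ℕ} .{{_ : NonZero p}} {n : ℕ} where

  codeword : (Vec (𝔽 p) n → 𝔽 p) → 𝔽 p → Vec (𝔽 p) n → Vec (𝔽 p) (length (nonzeroVecs p n))
  codeword f s u = Vec.map (λ x → s *ᶠ f x +ᶠ u ∙ x) (fromList (nonzeroVecs p n))

  𝒞 : (Vec (𝔽 p) n → 𝔽 p) → Code (length (nonzeroVecs p n))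
  𝒞 f c = ∃₂ λ s u → c ≡ codeword f s u

{-# OPTIONS --safe #-}
module Submission where

open import Defs
open import Algebra.Bundles using (CommutativeRing)
open import Data.Bool.Base using (true; false; if_then_else_; not)
open import Data.Empty using (⊥-elim)
open import Data.Fin.Base using (Fin; toℕ; fromℕ<; _↑ˡ_; _↑ʳ_; reduce≥)
import Data.Fin.Properties as Fin
open import Data.Fin.Subset using () renaming (_∈_ to _∈ₛ_; _⊆_ to _⊆ₛ_; ∣_∣ to ∣_∣ₛ)
open import Data.Fin.Subset.Properties using (drop-∷-⊆)
import Data.Integer.Base as ℤ
import Data.Integer.Properties as ℤ
open import Data.List.Base as List
  using (List; []; _∷_; length; filter; allFin; cartesianProductWith; deduplicate) renaming (_++_ to _++ₗ_)
open import Data.List.Membership.Propositional using (_∈_)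
open import Data.List.Extrema.Nat using (max; argmax-all; ⊥≤max; xs≤max)
open import Data.List.Membership.Propositional.Properties using
  (∈-map⁺; ∈-map⁻; ∈-allFin; ∈-filter⁺; ∈-filter⁻; ∈-cartesianProductWith⁺; ∈-deduplicate⁺)
open import Data.List.Membership.Propositional.Properties.WithK using (unique∧set⇒bag)
open import Data.List.Properties using
  (map-++; map-∘; map-cong; length-tabulate; length-map; length-filter; length-deduplicate)
open import Data.List.Relation.Binary.BagAndSetEquality using (∼bag⇒↭)
open import Data.List.Relation.Binary.Permutation.Propositional.Properties using () renaming (map⁺ to ↭-map⁺)
open import Data.List.Relation.Unary.All as All using (All; []; _∷_)
open import Data.List.Relation.Unary.Any using (here; there)
open import Data.List.Relation.Unary.Unique.Propositional using (Unique; []; _∷_)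
open import Data.List.Relation.Unary.Unique.Propositional.Properties
  using (allFin⁺; cartesianProductWith⁺) renaming (map⁺ to Unique-map⁺; filter⁺ to Unique-filter⁺)
open import Data.Nat.Base hiding (_/_)
open import Data.Nat.Coprimality using (prime⇒coprime; coprime-Bézout)
open import Data.Nat.Divisibility using (_∣_; divides)
open import Data.Nat.DivMod using (_%_; m%n<n; m%n≤m; n%n≡0; m<n⇒m%n≡m; [m+kn]%n≡m%n; %-distribˡ-+; %-distribˡ-*)
open import Data.Nat.GCD using (module Bézout)
open import Data.Nat.ListAction using (sum)
open import Data.Nat.ListAction.Properties using (sum-++; sum-↭)
open import Data.Nat.Primality using (Prime; prime⇒nonTrivial)
open import Data.Nat.Properties
open import Data.List.Relation.Unary.Unique.DecPropositional.Properties _≟_ using (deduplicate-!)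
open import Data.Nat.Tactic.RingSolver using (solve-∀)
open import Data.Product.Base using (_×_; _,_; proj₁; proj₂; ∃)
open import Data.Rational.Unnormalised.Base as ℚᵘ using (*<*) renaming (_/_ to _/ᵘ_)
open import Data.Sum.Base using (_⊎_; inj₁; inj₂)
open import Data.Vec.Base as Vec using (Vec; []; _∷_; fromList; lookup; replicate; _++_)
open import Data.Vec.Properties using
  ( ≡-dec; ∷-injective; ++-injective; []=⇒lookup; lookup⇒[]=; lookup-map; lookup-replicate
  ; lookup-++ˡ; lookup-++ʳ; lookup-++-<; lookup-++-≥) renaming (map-cong to Vec-map-cong)
import Data.Vec.Relation.Unary.All as VecAll
import Data.Vec.Relation.Unary.All.Properties as VecAll
open import Function.Base using (_∘_; id; it)
open import Function.Bundles using (_⇔_; mk⇔; Equivalence)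
open import Level using (0ℓ)
open import Relation.Binary.Definitions using (DecidableEquality)
open import Relation.Binary.PropositionalEquality
  using (_≡_; _≢_; refl; sym; trans; cong; cong₂; subst; subst₂; isEquivalence; module ≡-Reasoning)
open import Relation.Nullary.Decidable using (Dec; yes; no; does; does-⇔; ¬?; _×-dec_)
open import Relation.Nullary.Negation using (¬_)
open import Relation.Unary using (Decidable)

-- Put n = m + r, write the points of the domain as pairs x ++ y and the linear part of a message
-- (s , u) as u = v ++ w, with x, v of length m and y, w of length r. A saturated ideal that meets
-- the upper level has every element of the lower level with full multiplicity p - 1, so f is the
-- indicator of S = { x ++ 0 : x ≠ 0 } ∪ { (-1,…,-1) ++ y : y ≠ 0 }; from then on only this
-- description is used (IsIdealIndicator).
--
-- Weights. The codeword of (s , u) differs from the values of the linear form u ∙ x on S only, where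
-- its entry is s + u ∙ x. So its weight and the number of zeros of s + u ∙ x on S have the same sum as
-- the number of nonzero values of u ∙ x and the number of its zeros on S (wt-relation). On the two
-- pieces of S the forms are s + v ∙ x and (s + τ) + w ∙ y, where τ = v ∙ (-1,…,-1). A nonzero linear
-- form takes every value equally often (equidistribution), so every count is explicit, and the
-- weight depends only on whether s, v, w vanish and on whether τ is 0, is -s, or is neither.
--
-- Distribution. For an arbitrary function h, the sum of h over the weights of the nonzero messages
-- equals the sum of frequency times h over the table (weight-sum): for fixed s ≠ 0 one sums over w,
-- then over v ≠ 0, where the values of τ are equidistributed again. With h the indicator of one
-- weight this is the frequency of that weight. It also shows that the weight of every nonzero message
-- is in the table; all of these are at least p ^ m + p ^ r - 2 > 0, which gives injectivity
-- of the encoding, hence the dimension, and the minimum distance. The Ashikhmin-Barg inequality fails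
-- because p times the least weight is at most Q, which is itself a weight.
--
-- Minimality. Suppose that the codeword of (s′ , u′) vanishes wherever that of (s , u) does. Off S the
-- entries are u ∙ x and u′ ∙ x, and S is so sparse that the zeros of u outside S span the kernel of u:
-- if y ≠ 0 then x ++ y or its negative lies outside S because p is odd, and x ++ 0 is the difference
-- of x ++ y and 0 ++ y for a nonzero y with w ∙ y = 0. Hence u′ is a multiple a u of u
-- (kernel-inclusion). If u ≠ 0, a point of S with u ∙ x = -s gives s′ = a s (ideal-solution).

-- Finite sums and enumerations

private variable
  A B C : Set
  P R : Set

-- The indicator of a decided proposition.
𝟙 : Dec P → ℕ
𝟙 d = if does d then 1 else 0

𝟙-yes : (d : Dec P) → P → 𝟙 d ≡ 1
𝟙-yes (yes _) _ = refl
𝟙-yes (no ¬p) p = ⊥-elim (¬p p)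

𝟙-no : (d : Dec P) → ¬ P → 𝟙 d ≡ 0
𝟙-no (yes p) ¬p = ⊥-elim (¬p p)
𝟙-no (no _)  _  = refl

𝟙-cong : (d : Dec P) (e : Dec R) → (P → R) → (R → P) → 𝟙 d ≡ 𝟙 e
𝟙-cong (yes p) e to _    = sym (𝟙-yes e (to p))
𝟙-cong (no ¬p) e _  from = sym (𝟙-no e (¬p ∘ from))

𝟙-¬ : (d : Dec P) → 𝟙 d + 𝟙 (¬? d) ≡ 1
𝟙-¬ (yes _) = refl
𝟙-¬ (no _)  = refl

𝟙-× : (d : Dec P) (e : Dec R) → 𝟙 (d ×-dec e) ≡ 𝟙 d * 𝟙 e
𝟙-× (yes _) (yes _) = refl
𝟙-× (yes _) (no _)  = refl
𝟙-× (no _)  _       = refl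

-- The sum of g over the entries of a list, with multiplicity.
∑ : List A → (A → ℕ) → ℕ
∑ xs g = sum (List.map g xs)

∑-cong : ∀ (xs : List A) {g h : A → ℕ} → (∀ x → g x ≡ h x) → ∑ xs g ≡ ∑ xs h
∑-cong xs g≗h = cong sum (map-cong g≗h xs)

∑-+ : ∀ (xs : List A) (g h : A → ℕ) → ∑ xs (λ x → g x + h x) ≡ ∑ xs g + ∑ xs h
∑-+ []       g h = refl
∑-+ (x ∷ xs) g h rewrite ∑-+ xs g h = lemma (g x) (h x) (∑ xs g) (∑ xs h)
  where
  lemma : ∀ a b c d → a + b + (c + d) ≡ a + c + (b + d)
  lemma = solve-∀

∑-*ˡ : ∀ (xs : List A) k (g : A → ℕ) → ∑ xs (λ x → k * g x) ≡ k * ∑ xs g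
∑-*ˡ []       k g = sym (*-zeroʳ k)
∑-*ˡ (x ∷ xs) k g rewrite ∑-*ˡ xs k g = sym (*-distribˡ-+ k (g x) _)

∑-const : ∀ (xs : List A) k → ∑ xs (λ _ → k) ≡ length xs * k
∑-const []       k = refl
∑-const (x ∷ xs) k = cong (k +_) (∑-const xs k)

∑-zero : ∀ (xs : List A) → ∑ xs (λ _ → 0) ≡ 0
∑-zero xs = trans (∑-const xs 0) (*-zeroʳ (length xs))

∑-map : ∀ (φ : A → B) (xs : List A) (g : B → ℕ) → ∑ (List.map φ xs) g ≡ ∑ xs (g ∘ φ)
∑-map φ xs g = cong sum (sym (map-∘ xs))

∑-++ : ∀ (xs ys : List A) (g : A → ℕ) → ∑ (xs ++ₗ ys) g ≡ ∑ xs g + ∑ ys g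
∑-++ xs ys g = trans (cong sum (map-++ g xs ys)) (sum-++ (List.map g xs) _)

∑-cartesianProductWith : ∀ (φ : A → B → C) xs ys (g : C → ℕ) →
  ∑ (cartesianProductWith φ xs ys) g ≡ ∑ xs (λ x → ∑ ys (λ y → g (φ x y)))
∑-cartesianProductWith φ []       ys g = refl
∑-cartesianProductWith φ (x ∷ xs) ys g = begin
  ∑ (List.map (φ x) ys ++ₗ cartesianProductWith φ xs ys) g
    ≡⟨ ∑-++ (List.map (φ x) ys) _ g ⟩
  ∑ (List.map (φ x) ys) g + ∑ (cartesianProductWith φ xs ys) g
    ≡⟨ cong₂ _+_ (∑-map (φ x) ys g) (∑-cartesianProductWith φ xs ys g) ⟩
  ∑ ys (λ y → g (φ x y)) + ∑ xs (λ x → ∑ ys (λ y → g (φ x y))) ∎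
  where open ≡-Reasoning

∑-filter : ∀ {P : A → Set} (P? : Decidable P) xs (g : A → ℕ) →
  ∑ (filter P? xs) g ≡ ∑ xs (λ x → 𝟙 (P? x) * g x)
∑-filter P? []       g = refl
∑-filter P? (x ∷ xs) g with does (P? x)
... | true  = cong₂ _+_ (sym (+-identityʳ (g x))) (∑-filter P? xs g)
... | false = ∑-filter P? xs g

length-filter-∑ : ∀ {P : A → Set} (P? : Decidable P) xs →
  length (filter P? xs) ≡ ∑ xs (λ x → 𝟙 (P? x))
length-filter-∑ P? xs = begin
  length (filter P? xs)               ≡⟨ *-identityʳ _ ⟨
  length (filter P? xs) * 1           ≡⟨ ∑-const (filter P? xs) 1 ⟨
  ∑ (filter P? xs) (λ _ → 1)          ≡⟨ ∑-filter P? xs (λ _ → 1) ⟩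
  ∑ xs (λ x → 𝟙 (P? x) * 1)           ≡⟨ ∑-cong xs (λ x → *-identityʳ _) ⟩
  ∑ xs (λ x → 𝟙 (P? x))               ∎
  where open ≡-Reasoning

-- A list in which every element of the type occurs exactly once.
record Enumerates (xs : List A) : Set where
  field
    unique   : Unique xs
    complete : ∀ x → x ∈ xs

open Enumerates public

module _ (_≟ᴬ_ : DecidableEquality A) where

  ∑-absent : ∀ (g : A → ℕ) c {xs} → All (c ≢_) xs → ∑ xs (λ x → 𝟙 (x ≟ᴬ c) * g x) ≡ 0
  ∑-absent g c []         = refl
  ∑-absent g c {x ∷ _} (c≢x ∷ p) rewrite 𝟙-no (x ≟ᴬ c) (c≢x ∘ sym) = ∑-absent g c p

  ∑-present : ∀ (g : A → ℕ) {c xs} → Unique xs → c ∈ xs → ∑ xs (λ x → 𝟙 (x ≟ᴬ c) * g x) ≡ g c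
  ∑-present g {c} (c≢ ∷ _) (here refl)
    rewrite 𝟙-yes (c ≟ᴬ c) refl | ∑-absent g c c≢ = trans (+-identityʳ _) (+-identityʳ _)
  ∑-present g {c} {x ∷ _} (x≢ ∷ u) (there c∈)
    rewrite 𝟙-no (x ≟ᴬ c) (All.lookup x≢ c∈) = ∑-present g u c∈

  module _ {xs : List A} (enum : Enumerates xs) where

    -- The indicator of equality with c acts as a delta function.
    ∑-single : ∀ (g : A → ℕ) c → ∑ xs (λ x → 𝟙 (x ≟ᴬ c) * g x) ≡ g c
    ∑-single g c = ∑-present g (unique enum) (complete enum c)

    ∑-split : ∀ (g : A → ℕ) c → ∑ xs g ≡ g c + ∑ xs (λ x → 𝟙 (¬? (x ≟ᴬ c)) * g x)
    ∑-split g c = begin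
      ∑ xs g
        ≡⟨ ∑-cong xs pointwise ⟩
      ∑ xs (λ x → 𝟙 (x ≟ᴬ c) * g x + 𝟙 (¬? (x ≟ᴬ c)) * g x)
        ≡⟨ ∑-+ xs _ _ ⟩
      ∑ xs (λ x → 𝟙 (x ≟ᴬ c) * g x) + ∑ xs (λ x → 𝟙 (¬? (x ≟ᴬ c)) * g x)
        ≡⟨ cong (_+ ∑ xs _) (∑-single g c) ⟩
      g c + ∑ xs (λ x → 𝟙 (¬? (x ≟ᴬ c)) * g x) ∎
      where
      open ≡-Reasoning
      pointwise : ∀ x → g x ≡ 𝟙 (x ≟ᴬ c) * g x + 𝟙 (¬? (x ≟ᴬ c)) * g x
      pointwise x = begin
        g x                                          ≡⟨ *-identityˡ _ ⟨
        1 * g x                                      ≡⟨ cong (_* g x) (𝟙-¬ (x ≟ᴬ c)) ⟨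
        (𝟙 (x ≟ᴬ c) + 𝟙 (¬? (x ≟ᴬ c))) * g x         ≡⟨ *-distribʳ-+ (g x) (𝟙 (x ≟ᴬ c)) _ ⟩
        𝟙 (x ≟ᴬ c) * g x + 𝟙 (¬? (x ≟ᴬ c)) * g x     ∎

    ∑-off-const : ∀ c k → k + ∑ xs (λ x → 𝟙 (¬? (x ≟ᴬ c)) * k) ≡ length xs * k
    ∑-off-const c k = trans (sym (∑-split (λ _ → k) c)) (∑-const xs k)

    ∑-constant-off : ∀ (g : A → ℕ) c k → (∀ x → x ≢ c → g x ≡ k) →
                     ∑ xs g ≡ g c + (length xs ∸ 1) * k
    ∑-constant-off g c k const = trans (∑-split g c) (cong (g c +_) (begin
      ∑ xs (λ x → 𝟙 (¬? (x ≟ᴬ c)) * g x)         ≡⟨ ∑-cong xs off ⟩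
      ∑ xs (λ x → 𝟙 (¬? (x ≟ᴬ c)) * k)           ≡⟨ m+n∸m≡n k _ ⟨
      k + ∑ xs (λ x → 𝟙 (¬? (x ≟ᴬ c)) * k) ∸ k   ≡⟨ cong (_∸ k) (∑-off-const c k) ⟩
      length xs * k ∸ k                          ≡⟨ cong (length xs * k ∸_) (*-identityˡ k) ⟨
      length xs * k ∸ 1 * k                      ≡⟨ *-distribʳ-∸ k (length xs) 1 ⟨
      (length xs ∸ 1) * k                        ∎))
      where
      open ≡-Reasoning
      off : ∀ x → 𝟙 (¬? (x ≟ᴬ c)) * g x ≡ 𝟙 (¬? (x ≟ᴬ c)) * k
      off x with x ≟ᴬ c
      ... | yes _   = refl
      ... | no  x≢c = cong (_+ 0) (const x x≢c)

∑-bijection : ∀ {xs : List A} → Enumerates xs → (φ ψ : A → A) →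
  (∀ x → ψ (φ x) ≡ x) → (∀ x → φ (ψ x) ≡ x) →
  ∀ (g : A → ℕ) → ∑ xs (g ∘ φ) ≡ ∑ xs g
∑-bijection {xs = xs} enum φ ψ ψφ φψ g = begin
  ∑ xs (g ∘ φ)           ≡⟨ ∑-map φ xs g ⟨
  ∑ (List.map φ xs) g    ≡⟨ sum-↭ (↭-map⁺ g (∼bag⇒↭ (unique∧set⇒bag unique-map (unique enum) same))) ⟩
  ∑ xs g                 ∎
  where
  open ≡-Reasoning
  unique-map : Unique (List.map φ xs)
  unique-map = Unique-map⁺ (λ {x} {y} eq → trans (sym (ψφ x)) (trans (cong ψ eq) (ψφ y))) (unique enum)
  same : ∀ {x} → x ∈ List.map φ xs ⇔ x ∈ xs
  same {x} = mk⇔ (λ _ → complete enum x)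
                 (λ _ → subst (_∈ List.map φ xs) (φψ x) (∈-map⁺ φ (complete enum (ψ x))))

∑-zero⁻ : ∀ {A : Set} {xs : List A} (g : A → ℕ) {x} → x ∈ xs → ∑ xs g ≡ 0 → g x ≡ 0
∑-zero⁻ g {x} (here refl) eq = m+n≡0⇒m≡0 (g x) eq
∑-zero⁻ g {x} (there {x = y} x∈) eq = ∑-zero⁻ g x∈ (m+n≡0⇒n≡0 (g y) eq)

-- The field with p elements

module _ {p : ℕ} .{{_ : NonZero p}} where

  toℕ-[] : ∀ k → toℕ {p} [ k ]ᶠ ≡ k % p
  toℕ-[] k = Fin.toℕ-fromℕ< (m%n<n k p)

  []-cong-% : ∀ {i j} → i % p ≡ j % p → [ i ]ᶠ ≡ [_]ᶠ {p} j
  []-cong-% {i} {j} eq = Fin.toℕ-injective (trans (toℕ-[] i) (trans eq (sym (toℕ-[] j))))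

  [toℕ] : ∀ (a : 𝔽 p) → [ toℕ a ]ᶠ ≡ a
  [toℕ] a = Fin.toℕ-injective (trans (toℕ-[] (toℕ a)) (m<n⇒m%n≡m (Fin.toℕ<n a)))

  []-+ : ∀ i j → [ i ]ᶠ +ᶠ [ j ]ᶠ ≡ [_]ᶠ {p} (i + j)
  []-+ i j = []-cong-% (begin
    (toℕ {p} [ i ]ᶠ + toℕ {p} [ j ]ᶠ) % p  ≡⟨ cong₂ (λ a b → (a + b) % p) (toℕ-[] i) (toℕ-[] j) ⟩
    (i % p + j % p) % p                    ≡⟨ %-distribˡ-+ i j p ⟨
    (i + j) % p                            ∎)
    where open ≡-Reasoning

  []-* : ∀ i j → [ i ]ᶠ *ᶠ [ j ]ᶠ ≡ [_]ᶠ {p} (i * j)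
  []-* i j = []-cong-% (begin
    (toℕ {p} [ i ]ᶠ * toℕ {p} [ j ]ᶠ) % p  ≡⟨ cong₂ (λ a b → (a * b) % p) (toℕ-[] i) (toℕ-[] j) ⟩
    (i % p * (j % p)) % p                  ≡⟨ %-distribˡ-* i j p ⟨
    (i * j) % p                            ∎)
    where open ≡-Reasoning

  [p] : [ p ]ᶠ ≡ 0ᶠ {p}
  [p] = []-cong-% (trans (n%n≡0 p) (sym (0%p≡0)))
    where
    0%p≡0 : 0 % p ≡ 0
    0%p≡0 = n≤0⇒n≡0 (m%n≤m 0 p)

  infix 8 -ᶠ_

  -ᶠ_ : 𝔽 p → 𝔽 p
  -ᶠ a = [ p ∸ toℕ a ]ᶠ

  private
    -- Each law of the ring is read off from the law of the natural numbers, since every element is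
    -- the class of a natural number and taking classes commutes with sums and products.
    +-assoc′ : ∀ (a b c : 𝔽 p) → (a +ᶠ b) +ᶠ c ≡ a +ᶠ (b +ᶠ c)
    +-assoc′ a b c = begin
      (a +ᶠ b) +ᶠ c                         ≡⟨ cong ((a +ᶠ b) +ᶠ_) ([toℕ] c) ⟨
      (a +ᶠ b) +ᶠ [ toℕ c ]ᶠ                ≡⟨ []-+ _ (toℕ c) ⟩
      [ toℕ a + toℕ b + toℕ c ]ᶠ            ≡⟨ cong [_]ᶠ (+-assoc (toℕ a) _ _) ⟩
      [ toℕ a + (toℕ b + toℕ c) ]ᶠ          ≡⟨ []-+ (toℕ a) _ ⟨
      [ toℕ a ]ᶠ +ᶠ (b +ᶠ c)                ≡⟨ cong (_+ᶠ (b +ᶠ c)) ([toℕ] a) ⟩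
      a +ᶠ (b +ᶠ c)                         ∎
      where open ≡-Reasoning

    *-assoc′ : ∀ (a b c : 𝔽 p) → (a *ᶠ b) *ᶠ c ≡ a *ᶠ (b *ᶠ c)
    *-assoc′ a b c = begin
      (a *ᶠ b) *ᶠ c                         ≡⟨ cong ((a *ᶠ b) *ᶠ_) ([toℕ] c) ⟨
      (a *ᶠ b) *ᶠ [ toℕ c ]ᶠ                ≡⟨ []-* _ (toℕ c) ⟩
      [ toℕ a * toℕ b * toℕ c ]ᶠ            ≡⟨ cong [_]ᶠ (*-assoc (toℕ a) _ _) ⟩
      [ toℕ a * (toℕ b * toℕ c) ]ᶠ          ≡⟨ []-* (toℕ a) _ ⟨
      [ toℕ a ]ᶠ *ᶠ (b *ᶠ c)                ≡⟨ cong (_*ᶠ (b *ᶠ c)) ([toℕ] a) ⟩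
      a *ᶠ (b *ᶠ c)                         ∎
      where open ≡-Reasoning

    +-comm′ : ∀ (a b : 𝔽 p) → a +ᶠ b ≡ b +ᶠ a
    +-comm′ a b = cong [_]ᶠ (+-comm (toℕ a) _)

    *-comm′ : ∀ (a b : 𝔽 p) → a *ᶠ b ≡ b *ᶠ a
    *-comm′ a b = cong [_]ᶠ (*-comm (toℕ a) _)

    distribˡ′ : ∀ (a b c : 𝔽 p) → a *ᶠ (b +ᶠ c) ≡ a *ᶠ b +ᶠ a *ᶠ c
    distribˡ′ a b c = begin
      a *ᶠ (b +ᶠ c)                           ≡⟨ cong (_*ᶠ (b +ᶠ c)) ([toℕ] a) ⟨
      [ toℕ a ]ᶠ *ᶠ (b +ᶠ c)                  ≡⟨ []-* (toℕ a) _ ⟩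
      [ toℕ a * (toℕ b + toℕ c) ]ᶠ            ≡⟨ cong [_]ᶠ (*-distribˡ-+ (toℕ a) _ _) ⟩
      [ toℕ a * toℕ b + toℕ a * toℕ c ]ᶠ      ≡⟨ []-+ (toℕ a * toℕ b) _ ⟨
      a *ᶠ b +ᶠ a *ᶠ c                        ∎
      where open ≡-Reasoning

    +-identityˡ′ : ∀ (a : 𝔽 p) → 0ᶠ +ᶠ a ≡ a
    +-identityˡ′ a = trans (cong (0ᶠ +ᶠ_) (sym ([toℕ] a))) (trans ([]-+ 0 (toℕ a)) ([toℕ] a))

    *-identityˡ′ : ∀ (a : 𝔽 p) → 1ᶠ *ᶠ a ≡ a
    *-identityˡ′ a = begin
      1ᶠ *ᶠ a            ≡⟨ cong (1ᶠ *ᶠ_) ([toℕ] a) ⟨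
      1ᶠ *ᶠ [ toℕ a ]ᶠ   ≡⟨ []-* 1 (toℕ a) ⟩
      [ 1 * toℕ a ]ᶠ     ≡⟨ cong [_]ᶠ (*-identityˡ _) ⟩
      [ toℕ a ]ᶠ         ≡⟨ [toℕ] a ⟩
      a                  ∎
      where open ≡-Reasoning

    -‿inverseʳ′ : ∀ (a : 𝔽 p) → a +ᶠ -ᶠ a ≡ 0ᶠ
    -‿inverseʳ′ a = begin
      a +ᶠ -ᶠ a                   ≡⟨ cong (_+ᶠ -ᶠ a) ([toℕ] a) ⟨
      [ toℕ a ]ᶠ +ᶠ -ᶠ a          ≡⟨ []-+ (toℕ a) _ ⟩
      [ toℕ a + (p ∸ toℕ a) ]ᶠ    ≡⟨ cong [_]ᶠ (m+[n∸m]≡n (<⇒≤ (Fin.toℕ<n a))) ⟩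
      [ p ]ᶠ                      ≡⟨ [p] ⟩
      0ᶠ                          ∎
      where open ≡-Reasoning

  𝔽-commutativeRing : CommutativeRing 0ℓ 0ℓ
  𝔽-commutativeRing = record
    { Carrier = 𝔽 p ; _≈_ = _≡_ ; _+_ = _+ᶠ_ ; _*_ = _*ᶠ_ ; -_ = -ᶠ_ ; 0# = 0ᶠ ; 1# = 1ᶠ
    ; isCommutativeRing = record
      { isRing = record
        { +-isAbelianGroup = record
          { isGroup = record
            { isMonoid = record
              { isSemigroup = record
                { isMagma = record { isEquivalence = isEquivalence ; ∙-cong = cong₂ _+ᶠ_ }
                ; assoc = +-assoc′ }
              ; identity = +-identityˡ′ , λ a → trans (+-comm′ a 0ᶠ) (+-identityˡ′ a) }
            ; inverse = (λ a → trans (+-comm′ (-ᶠ a) a) (-‿inverseʳ′ a)) , -‿inverseʳ′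
            ; ⁻¹-cong = cong -ᶠ_ }
          ; comm = +-comm′ }
        ; *-cong = cong₂ _*ᶠ_
        ; *-assoc = *-assoc′
        ; *-identity = *-identityˡ′ , λ a → trans (*-comm′ a 1ᶠ) (*-identityˡ′ a)
        ; distrib = distribˡ′ , λ a b c → trans (*-comm′ (b +ᶠ c) a)
            (trans (distribˡ′ a b c) (cong₂ _+ᶠ_ (*-comm′ a b) (*-comm′ a c))) }
      ; *-comm = *-comm′ } }

  module 𝔽ᵣ = CommutativeRing 𝔽-commutativeRing

-- Linear algebra over the field

infix 4 _≟ⱽ_

_≟ⱽ_ : ∀ {p n} → DecidableEquality (Vec (𝔽 p) n)
_≟ⱽ_ = ≡-dec Fin._≟_

module _ {p : ℕ} .{{_ : NonZero p}} where

  open import Algebra.Properties.CommutativeSemigroup (𝔽ᵣ.+-commutativeSemigroup {p})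
    using () renaming (interchange to +ᶠ-interchange)
  open import Algebra.Properties.CommutativeSemigroup (𝔽ᵣ.*-commutativeSemigroup {p})
    using () renaming (x∙yz≈y∙xz to *ᶠ-left-comm)
  open 𝔽ᵣ {p} using () renaming
    ( +-assoc to +ᶠ-assoc; +-identityˡ to +ᶠ-identityˡ; +-identityʳ to +ᶠ-identityʳ
    ; *-assoc to *ᶠ-assoc; *-comm to *ᶠ-comm; *-identityˡ to *ᶠ-identityˡ; *-identityʳ to *ᶠ-identityʳ
    ; distribˡ to *ᶠ-distribˡ; distribʳ to *ᶠ-distribʳ
    ; zeroˡ to *ᶠ-zeroˡ; zeroʳ to *ᶠ-zeroʳ
    ; -‿inverseˡ to +ᶠ-inverseˡ; -‿inverseʳ to +ᶠ-inverseʳ)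
  open import Algebra.Properties.Ring (𝔽ᵣ.ring {p})
    using () renaming (-‿distribˡ-* to -ᶠ-distribˡ-*; -‿distribʳ-* to -ᶠ-distribʳ-*)
  open import Algebra.Properties.Group (𝔽ᵣ.+-group {p})
    using () renaming (inverseˡ-unique to -ᶠ-uniqueˡ; inverseʳ-unique to -ᶠ-uniqueʳ
          ; ⁻¹-involutive to -ᶠ-involutive; ε⁻¹≈ε to -ᶠ-zero)

  ∙-comm : ∀ {k} (u x : Vec (𝔽 p) k) → u ∙ x ≡ x ∙ u
  ∙-comm []      []      = refl
  ∙-comm (a ∷ u) (b ∷ x) = cong₂ _+ᶠ_ (*ᶠ-comm a b) (∙-comm u x)

  ∙-+ʳ : ∀ {k} (u x y : Vec (𝔽 p) k) → u ∙ (x +ᵛ y) ≡ u ∙ x +ᶠ u ∙ y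
  ∙-+ʳ []      []      []      = sym (+ᶠ-identityˡ 0ᶠ)
  ∙-+ʳ (a ∷ u) (b ∷ x) (c ∷ y) = begin
    a *ᶠ (b +ᶠ c) +ᶠ u ∙ (x +ᵛ y)              ≡⟨ cong₂ _+ᶠ_ (*ᶠ-distribˡ a b c) (∙-+ʳ u x y) ⟩
    a *ᶠ b +ᶠ a *ᶠ c +ᶠ (u ∙ x +ᶠ u ∙ y)       ≡⟨ +ᶠ-interchange (a *ᶠ b) _ _ _ ⟩
    a *ᶠ b +ᶠ u ∙ x +ᶠ (a *ᶠ c +ᶠ u ∙ y)       ∎
    where open ≡-Reasoning

  ∙-+ˡ : ∀ {k} (u v x : Vec (𝔽 p) k) → (u +ᵛ v) ∙ x ≡ u ∙ x +ᶠ v ∙ x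
  ∙-+ˡ u v x = trans (∙-comm (u +ᵛ v) x)
    (trans (∙-+ʳ x u v) (cong₂ _+ᶠ_ (∙-comm x u) (∙-comm x v)))

  ∙-*ʳ : ∀ {k} (u : Vec (𝔽 p) k) a x → u ∙ (a *ᵛ x) ≡ a *ᶠ (u ∙ x)
  ∙-*ʳ []      a []      = sym (*ᶠ-zeroʳ a)
  ∙-*ʳ (b ∷ u) a (c ∷ x) = begin
    b *ᶠ (a *ᶠ c) +ᶠ u ∙ (a *ᵛ x)    ≡⟨ cong₂ _+ᶠ_ (*ᶠ-left-comm b a c) (∙-*ʳ u a x) ⟩
    a *ᶠ (b *ᶠ c) +ᶠ a *ᶠ (u ∙ x)    ≡⟨ *ᶠ-distribˡ a _ _ ⟨
    a *ᶠ (b *ᶠ c +ᶠ u ∙ x)           ∎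
    where open ≡-Reasoning

  ∙-*ˡ : ∀ {k} a (u x : Vec (𝔽 p) k) → (a *ᵛ u) ∙ x ≡ a *ᶠ (u ∙ x)
  ∙-*ˡ a u x = trans (∙-comm (a *ᵛ u) x) (trans (∙-*ʳ x a u) (cong (a *ᶠ_) (∙-comm x u)))

  ∙-zeroʳ : ∀ {k} (u : Vec (𝔽 p) k) → u ∙ 0ᵛ ≡ 0ᶠ
  ∙-zeroʳ []      = refl
  ∙-zeroʳ (a ∷ u) = trans (cong₂ _+ᶠ_ (*ᶠ-zeroʳ a) (∙-zeroʳ u)) (+ᶠ-identityˡ 0ᶠ)

  ∙-zeroˡ : ∀ {k} (x : Vec (𝔽 p) k) → 0ᵛ ∙ x ≡ 0ᶠ
  ∙-zeroˡ x = trans (∙-comm 0ᵛ x) (∙-zeroʳ x)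

  ∙-++ : ∀ {j k} (v x : Vec (𝔽 p) j) (w y : Vec (𝔽 p) k) → (v ++ w) ∙ (x ++ y) ≡ v ∙ x +ᶠ w ∙ y
  ∙-++ []      []      w y = sym (+ᶠ-identityˡ _)
  ∙-++ (a ∷ v) (b ∷ x) w y = trans (cong (a *ᶠ b +ᶠ_) (∙-++ v x w y)) (sym (+ᶠ-assoc (a *ᶠ b) _ _))

  *ᵛ-zeroˡ : ∀ {k} (x : Vec (𝔽 p) k) → 0ᶠ *ᵛ x ≡ 0ᵛ
  *ᵛ-zeroˡ []      = refl
  *ᵛ-zeroˡ (a ∷ x) = cong₂ _∷_ (*ᶠ-zeroˡ a) (*ᵛ-zeroˡ x)

  *ᵛ-zeroʳ : ∀ {k} a → a *ᵛ 0ᵛ {n = k} ≡ 0ᵛ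
  *ᵛ-zeroʳ {zero}  a = refl
  *ᵛ-zeroʳ {suc k} a = cong₂ _∷_ (*ᶠ-zeroʳ a) (*ᵛ-zeroʳ a)

  *ᵛ-identityˡ : ∀ {k} (x : Vec (𝔽 p) k) → 1ᶠ *ᵛ x ≡ x
  *ᵛ-identityˡ []      = refl
  *ᵛ-identityˡ (a ∷ x) = cong₂ _∷_ (*ᶠ-identityˡ a) (*ᵛ-identityˡ x)

  +ᵛ-identityʳ : ∀ {k} (x : Vec (𝔽 p) k) → x +ᵛ 0ᵛ ≡ x
  +ᵛ-identityʳ []      = refl
  +ᵛ-identityʳ (a ∷ x) = cong₂ _∷_ (+ᶠ-identityʳ a) (+ᵛ-identityʳ x)

  +ᵛ-identityˡ : ∀ {k} (x : Vec (𝔽 p) k) → 0ᵛ +ᵛ x ≡ x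
  +ᵛ-identityˡ []      = refl
  +ᵛ-identityˡ (a ∷ x) = cong₂ _∷_ (+ᶠ-identityˡ a) (+ᵛ-identityˡ x)

  private
    difference-zero : ∀ (a b c : 𝔽 p) → b +ᶠ (-ᶠ a) *ᶠ c ≡ 0ᶠ → b ≡ a *ᶠ c
    difference-zero a b c eq = begin
      b                     ≡⟨ -ᶠ-uniqueˡ b _ eq ⟩
      -ᶠ ((-ᶠ a) *ᶠ c)      ≡⟨ cong -ᶠ_ (-ᶠ-distribˡ-* a c) ⟨
      -ᶠ (-ᶠ (a *ᶠ c))      ≡⟨ -ᶠ-involutive _ ⟩
      a *ᶠ c                ∎
      where open ≡-Reasoning

  -- If x - a y = 0 then x = a y.
  vec-difference-zero : ∀ {k} a (x y : Vec (𝔽 p) k) → x +ᵛ (-ᶠ a) *ᵛ y ≡ 0ᵛ → x ≡ a *ᵛ y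
  vec-difference-zero a []      []      _  = refl
  vec-difference-zero a (b ∷ x) (c ∷ y) eq with eq₁ , eq₂ ← ∷-injective eq =
    cong₂ _∷_ (difference-zero a b c eq₁) (vec-difference-zero a x y eq₂)

  ++-zero : ∀ j k → 0ᵛ {p} {n = j} ++ 0ᵛ {n = k} ≡ 0ᵛ
  ++-zero zero    k = refl
  ++-zero (suc j) k = cong (0ᶠ ∷_) (++-zero j k)

  +ᵛ-++ : ∀ {j k} (v x : Vec (𝔽 p) j) (w y : Vec (𝔽 p) k) →
          (v ++ w) +ᵛ (x ++ y) ≡ (v +ᵛ x) ++ (w +ᵛ y)
  +ᵛ-++ []      []      w y = refl
  +ᵛ-++ (a ∷ v) (b ∷ x) w y = cong (a +ᶠ b ∷_) (+ᵛ-++ v x w y)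

  *ᵛ-++ : ∀ {j k} a (v : Vec (𝔽 p) j) (w : Vec (𝔽 p) k) → a *ᵛ (v ++ w) ≡ (a *ᵛ v) ++ (a *ᵛ w)
  *ᵛ-++ a []      w = refl
  *ᵛ-++ a (b ∷ v) w = cong (a *ᶠ b ∷_) (*ᵛ-++ a v w)

  allFin-enumerates : Enumerates (allFin p)
  allFin-enumerates = record { unique = allFin⁺ p ; complete = ∈-allFin }

  length-allFin : length (allFin p) ≡ p
  length-allFin = length-tabulate {n = p} (λ i → i)

  allVecs-enumerates : ∀ k → Enumerates (allVecs p k)
  allVecs-enumerates zero    = record { unique = [] ∷ [] ; complete = λ { [] → here refl } }
  allVecs-enumerates (suc k) = record
    { unique   = cartesianProductWith⁺ _∷_ ∷-injective (unique allFin-enumerates) (unique (allVecs-enumerates k))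
    ; complete = λ { (a ∷ x) → ∈-cartesianProductWith⁺ _∷_
                       (complete allFin-enumerates a) (complete (allVecs-enumerates k) x) } }

  length-∑ : ∀ {A : Set} (xs : List A) → ∑ xs (λ _ → 1) ≡ length xs
  length-∑ xs = trans (∑-const xs 1) (*-identityʳ _)

  length-allVecs : ∀ k → length (allVecs p k) ≡ p ^ k
  length-allVecs zero    = refl
  length-allVecs (suc k) = begin
    length (allVecs p (suc k))                              ≡⟨ length-∑ (allVecs p (suc k)) ⟨
    ∑ (allVecs p (suc k)) (λ _ → 1)                         ≡⟨ ∑-cartesianProductWith _∷_ (allFin p) _ _ ⟩
    ∑ (allFin p) (λ _ → ∑ (allVecs p k) (λ _ → 1))          ≡⟨ ∑-const (allFin p) _ ⟩
    length (allFin p) * ∑ (allVecs p k) (λ _ → 1)           ≡⟨ cong₂ _*_ length-allFin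
                                                                 (trans (length-∑ (allVecs p k)) (length-allVecs k)) ⟩
    p * p ^ k                                               ∎
    where open ≡-Reasoning

  ∑-++-split : ∀ j k (g : Vec (𝔽 p) (j + k) → ℕ) →
    ∑ (allVecs p (j + k)) g ≡ ∑ (allVecs p j) (λ x → ∑ (allVecs p k) (λ y → g (x ++ y)))
  ∑-++-split zero    k g = sym (+-identityʳ _)
  ∑-++-split (suc j) k g = begin
    ∑ (allVecs p (suc j + k)) g
      ≡⟨ ∑-cartesianProductWith _∷_ (allFin p) _ g ⟩
    ∑ (allFin p) (λ a → ∑ (allVecs p (j + k)) (λ x → g (a ∷ x)))
      ≡⟨ ∑-cong (allFin p) (λ a → ∑-++-split j k (λ x → g (a ∷ x))) ⟩
    ∑ (allFin p) (λ a → ∑ (allVecs p j) (λ x → ∑ (allVecs p k) (λ y → g (a ∷ (x ++ y)))))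
      ≡⟨ ∑-cartesianProductWith _∷_ (allFin p) _ _ ⟨
    ∑ (allVecs p (suc j)) (λ x → ∑ (allVecs p k) (λ y → g (x ++ y))) ∎
    where open ≡-Reasoning

  []≢[] : ∀ {i j} → i < p → j < p → i ≢ j → [_]ᶠ {p} i ≢ [ j ]ᶠ
  []≢[] {i} {j} i<p j<p i≢j eq = i≢j (begin
    i              ≡⟨ m<n⇒m%n≡m i<p ⟨
    i % p          ≡⟨ toℕ-[] i ⟨
    toℕ {p} [ i ]ᶠ ≡⟨ cong toℕ eq ⟩
    toℕ {p} [ j ]ᶠ ≡⟨ toℕ-[] j ⟩
    j % p          ≡⟨ m<n⇒m%n≡m j<p ⟩
    j              ∎)
    where open ≡-Reasoning

  module _ (isPrime : Prime p) where

    1≢0 : 1ᶠ {p} ≢ 0ᶠ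
    1≢0 = []≢[] 1<p (<-trans 0<1+n 1<p) (λ ())
      where
      1<p : 1 < p
      1<p = nonTrivial⇒n>1 p {{prime⇒nonTrivial isPrime}}

    -- From a Bézout identity for p and the representative of a.
    inverse : ∀ (a : 𝔽 p) → a ≢ 0ᶠ → ∃ λ b → a *ᶠ b ≡ 1ᶠ
    inverse a a≢0 with coprime-Bézout (prime⇒coprime isPrime {{≢-nonZero toℕa≢0}} (Fin.toℕ<n a))
      where
      toℕa≢0 : toℕ a ≢ 0
      toℕa≢0 eq = a≢0 (trans (sym ([toℕ] a)) (cong [_]ᶠ eq))
    ... | Bézout.-+ x y eq = [ y ]ᶠ , (begin
      a *ᶠ [ y ]ᶠ             ≡⟨ cong (_*ᶠ [ y ]ᶠ) ([toℕ] a) ⟨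
      [ toℕ a ]ᶠ *ᶠ [ y ]ᶠ    ≡⟨ []-* (toℕ a) y ⟩
      [ toℕ a * y ]ᶠ          ≡⟨ cong [_]ᶠ (trans (*-comm (toℕ a) y) (sym eq)) ⟩
      [ 1 + x * p ]ᶠ          ≡⟨ []-cong-% ([m+kn]%n≡m%n 1 x p) ⟩
      1ᶠ                      ∎)
      where open ≡-Reasoning
    ... | Bézout.+- x y eq = -ᶠ [ y ]ᶠ , (begin
      a *ᶠ -ᶠ [ y ]ᶠ              ≡⟨ -ᶠ-distribʳ-* a [ y ]ᶠ ⟨
      -ᶠ (a *ᶠ [ y ]ᶠ)            ≡⟨ -ᶠ-uniqueˡ 1ᶠ _ 1+ay≡0 ⟨
      1ᶠ                          ∎)
      where
      open ≡-Reasoning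
      1+ay≡0 : 1ᶠ +ᶠ a *ᶠ [ y ]ᶠ ≡ 0ᶠ
      1+ay≡0 = begin
        1ᶠ +ᶠ a *ᶠ [ y ]ᶠ             ≡⟨ cong (λ b → 1ᶠ +ᶠ b *ᶠ [ y ]ᶠ) ([toℕ] a) ⟨
        1ᶠ +ᶠ [ toℕ a ]ᶠ *ᶠ [ y ]ᶠ    ≡⟨ cong (1ᶠ +ᶠ_) ([]-* (toℕ a) y) ⟩
        1ᶠ +ᶠ [ toℕ a * y ]ᶠ          ≡⟨ []-+ 1 (toℕ a * y) ⟩
        [ 1 + toℕ a * y ]ᶠ            ≡⟨ cong (λ k → [ 1 + k ]ᶠ) (*-comm (toℕ a) y) ⟩
        [ 1 + y * toℕ a ]ᶠ            ≡⟨ cong [_]ᶠ eq ⟩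
        [ x * p ]ᶠ                    ≡⟨ []-cong-% ([m+kn]%n≡m%n 0 x p) ⟩
        0ᶠ                            ∎

    *ᶠ-cancel-zero : ∀ {a b : 𝔽 p} → a ≢ 0ᶠ → a *ᶠ b ≡ 0ᶠ → b ≡ 0ᶠ
    *ᶠ-cancel-zero {a} {b} a≢0 eq with c , ac≡1 ← inverse a a≢0 = begin
      b                  ≡⟨ *ᶠ-identityˡ b ⟨
      1ᶠ *ᶠ b            ≡⟨ cong (_*ᶠ b) (trans (sym ac≡1) (*ᶠ-comm a c)) ⟩
      (c *ᶠ a) *ᶠ b      ≡⟨ *ᶠ-assoc c a b ⟩
      c *ᶠ (a *ᶠ b)      ≡⟨ cong (c *ᶠ_) eq ⟩
      c *ᶠ 0ᶠ            ≡⟨ *ᶠ-zeroʳ c ⟩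
      0ᶠ                 ∎
      where open ≡-Reasoning

    ∙-surjective : ∀ {k} (u : Vec (𝔽 p) k) → u ≢ 0ᵛ → ∀ t → ∃ λ x → u ∙ x ≡ t
    ∙-surjective []      u≢0 t = ⊥-elim (u≢0 refl)
    ∙-surjective (a ∷ u) u≢0 t with a Fin.≟ 0ᶠ
    ... | yes refl with x , eq ← ∙-surjective u (u≢0 ∘ cong (0ᶠ ∷_)) t =
      0ᶠ ∷ x , trans (cong₂ _+ᶠ_ (*ᶠ-zeroˡ 0ᶠ) eq) (+ᶠ-identityˡ t)
    ... | no a≢0 with c , ac≡1 ← inverse a a≢0 = c *ᶠ t ∷ 0ᵛ , (begin
      a *ᶠ (c *ᶠ t) +ᶠ u ∙ 0ᵛ    ≡⟨ cong (a *ᶠ (c *ᶠ t) +ᶠ_) (∙-zeroʳ u) ⟩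
      a *ᶠ (c *ᶠ t) +ᶠ 0ᶠ        ≡⟨ +ᶠ-identityʳ _ ⟩
      a *ᶠ (c *ᶠ t)              ≡⟨ *ᶠ-assoc a c t ⟨
      (a *ᶠ c) *ᶠ t              ≡⟨ cong (_*ᶠ t) ac≡1 ⟩
      1ᶠ *ᶠ t                    ≡⟨ *ᶠ-identityˡ t ⟩
      t                          ∎)
      where open ≡-Reasoning

    -- A linear form in at least two variables has a nontrivial zero.
    ∙-kernel : ∀ {k} (u : Vec (𝔽 p) (2 + k)) → ∃ λ x → x ≢ 0ᵛ × u ∙ x ≡ 0ᶠ
    ∙-kernel (a ∷ b ∷ u) with b Fin.≟ 0ᶠ
    ... | yes refl = 0ᶠ ∷ 1ᶠ ∷ 0ᵛ , (λ eq → 1≢0 (proj₁ (∷-injective (proj₂ (∷-injective eq))))) , (begin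
      a *ᶠ 0ᶠ +ᶠ (0ᶠ *ᶠ 1ᶠ +ᶠ u ∙ 0ᵛ)   ≡⟨ cong₂ _+ᶠ_ (*ᶠ-zeroʳ a) (cong₂ _+ᶠ_ (*ᶠ-zeroˡ 1ᶠ) (∙-zeroʳ u)) ⟩
      0ᶠ +ᶠ (0ᶠ +ᶠ 0ᶠ)                  ≡⟨ trans (+ᶠ-identityˡ _) (+ᶠ-identityˡ _) ⟩
      0ᶠ                                ∎)
      where open ≡-Reasoning
    ... | no b≢0 = b ∷ -ᶠ a ∷ 0ᵛ , (λ eq → b≢0 (proj₁ (∷-injective eq))) , (begin
      a *ᶠ b +ᶠ (b *ᶠ (-ᶠ a) +ᶠ u ∙ 0ᵛ)   ≡⟨ cong (λ c → a *ᶠ b +ᶠ (b *ᶠ (-ᶠ a) +ᶠ c)) (∙-zeroʳ u) ⟩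
      a *ᶠ b +ᶠ (b *ᶠ (-ᶠ a) +ᶠ 0ᶠ)       ≡⟨ cong (a *ᶠ b +ᶠ_) (+ᶠ-identityʳ _) ⟩
      a *ᶠ b +ᶠ b *ᶠ (-ᶠ a)               ≡⟨ cong (_+ᶠ b *ᶠ (-ᶠ a)) (*ᶠ-comm a b) ⟩
      b *ᶠ a +ᶠ b *ᶠ (-ᶠ a)               ≡⟨ *ᶠ-distribˡ b a _ ⟨
      b *ᶠ (a +ᶠ -ᶠ a)                    ≡⟨ cong (b *ᶠ_) (+ᶠ-inverseʳ a) ⟩
      b *ᶠ 0ᶠ                             ≡⟨ *ᶠ-zeroʳ b ⟩
      0ᶠ                                  ∎)
      where open ≡-Reasoning

    ∙-solution : ∀ {k} (u : Vec (𝔽 p) (2 + k)) t → (u ≢ 0ᵛ ⊎ t ≡ 0ᶠ) → ∃ λ x → x ≢ 0ᵛ × u ∙ x ≡ t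
    ∙-solution u t solvable with t Fin.≟ 0ᶠ
    ... | yes refl = ∙-kernel u
    ... | no t≢0 with solvable
    ...   | inj₂ t≡0 = ⊥-elim (t≢0 t≡0)
    ...   | inj₁ u≢0 with x , eq ← ∙-surjective u u≢0 t =
      x , (λ x≡0 → t≢0 (trans (sym eq) (trans (cong (u ∙_) x≡0) (∙-zeroʳ u)))) , eq

    -- If u′ ≢ λu for the only possible λ, then some y has (u′ - λu) ∙ y = 1, and
    -- subtracting from y its component outside the kernel of u gives a zero of u
    -- at which u′ takes the value 1.
    kernel-inclusion : ∀ {k} (u u′ : Vec (𝔽 p) k) → (∀ x → u ∙ x ≡ 0ᶠ → u′ ∙ x ≡ 0ᶠ) →
                       ∃ λ a → u′ ≡ a *ᵛ u
    kernel-inclusion {k} u u′ incl with u ≟ⱽ 0ᵛ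
    ... | yes refl = 0ᶠ , trans u′≡0 (sym (*ᵛ-zeroˡ 0ᵛ))
      where
      u′≡0 : u′ ≡ 0ᵛ
      u′≡0 with u′ ≟ⱽ 0ᵛ
      ... | yes eq = eq
      ... | no u′≢0 with x , eq ← ∙-surjective u′ u′≢0 1ᶠ =
        ⊥-elim (1≢0 (trans (sym eq) (incl x (∙-zeroˡ x))))
    ... | no u≢0 with x₀ , ux₀≡1 ← ∙-surjective u u≢0 1ᶠ = a , u′≡au
      where
      a : 𝔽 p
      a = u′ ∙ x₀
      v : Vec (𝔽 p) k
      v = u′ +ᵛ (-ᶠ a) *ᵛ u
      v-vanishes : ∀ y → v ∙ y ≡ 0ᶠ
      v-vanishes y = begin
        v ∙ y                              ≡⟨ ∙-+ˡ u′ _ y ⟩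
        u′ ∙ y +ᶠ ((-ᶠ a) *ᵛ u) ∙ y        ≡⟨ cong (u′ ∙ y +ᶠ_) (∙-*ˡ (-ᶠ a) u y) ⟩
        u′ ∙ y +ᶠ (-ᶠ a) *ᶠ (u ∙ y)        ≡⟨ cong (u′ ∙ y +ᶠ_) flip-sign ⟩
        u′ ∙ y +ᶠ (-ᶠ (u ∙ y)) *ᶠ a        ≡⟨ cong (u′ ∙ y +ᶠ_) (∙-*ʳ u′ (-ᶠ (u ∙ y)) x₀) ⟨
        u′ ∙ y +ᶠ u′ ∙ ((-ᶠ (u ∙ y)) *ᵛ x₀) ≡⟨ ∙-+ʳ u′ y _ ⟨
        u′ ∙ z                             ≡⟨ incl z uz≡0 ⟩
        0ᶠ                                 ∎
        where
        open ≡-Reasoning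
        z : Vec (𝔽 p) k
        z = y +ᵛ (-ᶠ (u ∙ y)) *ᵛ x₀
        flip-sign : (-ᶠ a) *ᶠ (u ∙ y) ≡ (-ᶠ (u ∙ y)) *ᶠ a
        flip-sign = trans (sym (-ᶠ-distribˡ-* a _))
          (trans (cong -ᶠ_ (*ᶠ-comm a _)) (-ᶠ-distribˡ-* (u ∙ y) a))
        uz≡0 : u ∙ z ≡ 0ᶠ
        uz≡0 = begin
          u ∙ z                                ≡⟨ ∙-+ʳ u y _ ⟩
          u ∙ y +ᶠ u ∙ ((-ᶠ (u ∙ y)) *ᵛ x₀)    ≡⟨ cong (u ∙ y +ᶠ_) (∙-*ʳ u (-ᶠ (u ∙ y)) x₀) ⟩
          u ∙ y +ᶠ (-ᶠ (u ∙ y)) *ᶠ (u ∙ x₀)    ≡⟨ cong (λ t → u ∙ y +ᶠ (-ᶠ (u ∙ y)) *ᶠ t) ux₀≡1 ⟩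
          u ∙ y +ᶠ (-ᶠ (u ∙ y)) *ᶠ 1ᶠ          ≡⟨ cong (u ∙ y +ᶠ_) (*ᶠ-identityʳ _) ⟩
          u ∙ y +ᶠ -ᶠ (u ∙ y)                  ≡⟨ +ᶠ-inverseʳ _ ⟩
          0ᶠ                                   ∎
      u′≡au : u′ ≡ a *ᵛ u
      u′≡au with v ≟ⱽ 0ᵛ
      ... | yes v≡0 = vec-difference-zero a u′ u v≡0
      ... | no v≢0 with y , vy≡1 ← ∙-surjective v v≢0 1ᶠ =
        ⊥-elim (1≢0 (trans (sym vy≡1) (v-vanishes y)))

    -- Induction on the number of variables. If the tail of the form vanishes, its values are those of
    -- b ↦ a b with a ≠ 0; otherwise the slice at each b takes the values of the tail translated by a b.
    equidistribution : ∀ {k} (u : Vec (𝔽 p) (suc k)) → u ≢ 0ᵛ → ∀ (g : 𝔽 p → ℕ) →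
      ∑ (allVecs p (suc k)) (λ x → g (u ∙ x)) ≡ p ^ k * ∑ (allFin p) g
    equidistribution {k} (a ∷ u) au≢0 g = trans (∑-cartesianProductWith _∷_ (allFin p) _ _) (by-tail u au≢0)
      where
      open ≡-Reasoning
      translate : ∀ c (h : 𝔽 p → ℕ) → ∑ (allFin p) (λ t → h (c +ᶠ t)) ≡ ∑ (allFin p) h
      translate c = ∑-bijection allFin-enumerates (c +ᶠ_) (-ᶠ c +ᶠ_)
        (λ t → trans (sym (+ᶠ-assoc _ c t)) (trans (cong (_+ᶠ t) (+ᶠ-inverseˡ c)) (+ᶠ-identityˡ t)))
        (λ t → trans (sym (+ᶠ-assoc c _ t)) (trans (cong (_+ᶠ t) (+ᶠ-inverseʳ c)) (+ᶠ-identityˡ t)))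
      by-tail : ∀ {k} (u : Vec (𝔽 p) k) → a ∷ u ≢ 0ᵛ →
        ∑ (allFin p) (λ b → ∑ (allVecs p k) (λ x → g (a *ᶠ b +ᶠ u ∙ x))) ≡ p ^ k * ∑ (allFin p) g
      by-tail {k} u au≢0 with u ≟ⱽ 0ᵛ
      ... | yes refl = begin
        ∑ (allFin p) (λ b → ∑ (allVecs p k) (λ x → g (a *ᶠ b +ᶠ 0ᵛ ∙ x)))
          ≡⟨ ∑-cong (allFin p) (λ b → trans (∑-cong (allVecs p k)
               (λ x → cong g (trans (cong (a *ᶠ b +ᶠ_) (∙-zeroˡ x)) (+ᶠ-identityʳ _))))
               (trans (∑-const (allVecs p k) _) (cong (_* g (a *ᶠ b)) (length-allVecs k)))) ⟩
        ∑ (allFin p) (λ b → p ^ k * g (a *ᶠ b))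
          ≡⟨ ∑-*ˡ (allFin p) (p ^ k) _ ⟩
        p ^ k * ∑ (allFin p) (λ b → g (a *ᶠ b))
          ≡⟨ cong (p ^ k *_) (scale g) ⟩
        p ^ k * ∑ (allFin p) g ∎
        where
        a≢0 : a ≢ 0ᶠ
        a≢0 a≡0 = au≢0 (cong (_∷ 0ᵛ) a≡0)
        scale : ∀ (h : 𝔽 p → ℕ) → ∑ (allFin p) (λ t → h (a *ᶠ t)) ≡ ∑ (allFin p) h
        scale with c , ac≡1 ← inverse a a≢0 = ∑-bijection allFin-enumerates (a *ᶠ_) (c *ᶠ_)
          (λ t → trans (sym (*ᶠ-assoc c a t)) (trans (cong (_*ᶠ t) (trans (*ᶠ-comm c a) ac≡1)) (*ᶠ-identityˡ t)))
          (λ t → trans (sym (*ᶠ-assoc a c t)) (trans (cong (_*ᶠ t) ac≡1) (*ᶠ-identityˡ t)))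
      by-tail {zero}  []      au≢0 | no u≢0 = ⊥-elim (u≢0 refl)
      by-tail {suc k} (b ∷ u) au≢0 | no u≢0 = begin
        ∑ (allFin p) (λ c → ∑ (allVecs p (suc k)) (λ x → g (a *ᶠ c +ᶠ (b ∷ u) ∙ x)))
          ≡⟨ ∑-cong (allFin p) (λ c → equidistribution (b ∷ u) u≢0 (λ t → g (a *ᶠ c +ᶠ t))) ⟩
        ∑ (allFin p) (λ c → p ^ k * ∑ (allFin p) (λ t → g (a *ᶠ c +ᶠ t)))
          ≡⟨ ∑-cong (allFin p) (λ c → cong (p ^ k *_) (translate (a *ᶠ c) g)) ⟩
        ∑ (allFin p) (λ c → p ^ k * ∑ (allFin p) g)
          ≡⟨ ∑-const (allFin p) _ ⟩
        length (allFin p) * (p ^ k * ∑ (allFin p) g)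
          ≡⟨ cong (_* (p ^ k * ∑ (allFin p) g)) length-allFin ⟩
        p * (p ^ k * ∑ (allFin p) g)
          ≡⟨ *-assoc p (p ^ k) _ ⟨
        p ^ suc k * ∑ (allFin p) g ∎

  -- The code of a function

  vec-difference : ∀ {k} (x y : Vec (𝔽 p) k) → x +ᵛ (-ᶠ 1ᶠ) *ᵛ y ≡ 0ᵛ → x ≡ y
  vec-difference x y eq = trans (vec-difference-zero 1ᶠ x y eq) (*ᵛ-identityˡ y)

  subtract-self : ∀ (a : 𝔽 p) → a +ᶠ (-ᶠ 1ᶠ) *ᶠ a ≡ 0ᶠ
  subtract-self a = trans
    (cong (a +ᶠ_) (trans (sym (-ᶠ-distribˡ-* 1ᶠ a)) (cong -ᶠ_ (*ᶠ-identityˡ a)))) (+ᶠ-inverseʳ a)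

  -- The Hamming distance is the weight of the difference.
  dist-wt : ∀ {k} (c c′ : Vec (𝔽 p) k) → dist c c′ ≡ wt (c +ᵛ (-ᶠ 1ᶠ) *ᵛ c′)
  dist-wt c c′ = cong ∣_∣ₛ (supports c c′)
    where
    supports : ∀ {k} (c c′ : Vec (𝔽 p) k) →
      Vec.zipWith (λ a b → not (does (a Fin.≟ b))) c c′ ≡ supp (c +ᵛ (-ᶠ 1ᶠ) *ᵛ c′)
    supports []      []       = refl
    supports (a ∷ c) (b ∷ c′) = cong₂ _∷_
      (cong not (does-⇔ (mk⇔ to from) (a Fin.≟ b) (a +ᶠ (-ᶠ 1ᶠ) *ᶠ b Fin.≟ 0ᶠ))) (supports c c′)
      where
      to : a ≡ b → a +ᶠ (-ᶠ 1ᶠ) *ᶠ b ≡ 0ᶠ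
      to refl = subtract-self a
      from : a +ᶠ (-ᶠ 1ᶠ) *ᶠ b ≡ 0ᶠ → a ≡ b
      from eq = proj₁ (∷-injective (vec-difference (a ∷ []) (b ∷ []) (cong (_∷ []) eq)))

  wt-0 : ∀ k → wt (0ᵛ {p} {n = k}) ≡ 0
  wt-0 zero    = refl
  wt-0 (suc k) with 0ᶠ {p} Fin.≟ 0ᶠ
  ... | yes _  = wt-0 k
  ... | no 0≢0 = ⊥-elim (0≢0 refl)

  map-+ᵛ : ∀ {A : Set} {k} (g h : A → 𝔽 p) (xs : Vec A k) →
    Vec.map g xs +ᵛ Vec.map h xs ≡ Vec.map (λ x → g x +ᶠ h x) xs
  map-+ᵛ g h []       = refl
  map-+ᵛ g h (x ∷ xs) = cong (g x +ᶠ h x ∷_) (map-+ᵛ g h xs)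

  map-*ᵛ : ∀ {A : Set} {k} a (g : A → 𝔽 p) (xs : Vec A k) → a *ᵛ Vec.map g xs ≡ Vec.map (λ x → a *ᶠ g x) xs
  map-*ᵛ a g []       = refl
  map-*ᵛ a g (x ∷ xs) = cong (a *ᶠ g x ∷_) (map-*ᵛ a g xs)

  supp-⊆-map : ∀ {A : Set} (xs : List A) (g g′ : A → 𝔽 p) →
    supp (Vec.map g′ (fromList xs)) ⊆ₛ supp (Vec.map g (fromList xs)) →
    ∀ {x} → x ∈ xs → g x ≡ 0ᶠ → g′ x ≡ 0ᶠ
  supp-⊆-map (x ∷ xs) g g′ sub (there x∈xs) = supp-⊆-map xs g g′ (drop-∷-⊆ sub) x∈xs
  supp-⊆-map (x ∷ xs) g g′ sub (here refl) gx≡0 with g′ x Fin.≟ 0ᶠ | g x Fin.≟ 0ᶠ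
  ... | yes g′x≡0 | _        = g′x≡0
  ... | no _      | no gx≢0  = ⊥-elim (gx≢0 gx≡0)
  ... | no _      | yes _ with () ← sub Vec.here

  -- Linear maps between coordinate spaces.
  record IsLinearMap {j k} (L : Vec (𝔽 p) j → Vec (𝔽 p) k) : Set where
    field
      L-+ : ∀ x y → L (x +ᵛ y) ≡ L x +ᵛ L y
      L-* : ∀ a x → L (a *ᵛ x) ≡ a *ᵛ L x

    L-0 : L 0ᵛ ≡ 0ᵛ
    L-0 = trans (cong L (sym (*ᵛ-zeroˡ 0ᵛ))) (trans (L-* 0ᶠ 0ᵛ) (*ᵛ-zeroˡ _))

    L-combination : ∀ {l} (a : Vec (𝔽 p) l) b → combination a (Vec.map L b) ≡ L (combination a b)
    L-combination []      []      = sym L-0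
    L-combination (c ∷ a) (x ∷ b) = sym (trans (L-+ _ _) (cong₂ _+ᵛ_ (L-* c x) (sym (L-combination a b))))

    kernel-trivial⇒injective : (∀ x → L x ≡ 0ᵛ → x ≡ 0ᵛ) → ∀ {x y} → L x ≡ L y → x ≡ y
    kernel-trivial⇒injective ker {x} {y} eq = vec-difference x y (ker _ (begin
      L (x +ᵛ (-ᶠ 1ᶠ) *ᵛ y)        ≡⟨ trans (L-+ x _) (cong (L x +ᵛ_) (L-* (-ᶠ 1ᶠ) y)) ⟩
      L x +ᵛ (-ᶠ 1ᶠ) *ᵛ L y        ≡⟨ cong (λ z → L x +ᵛ (-ᶠ 1ᶠ) *ᵛ z) eq ⟨
      L x +ᵛ (-ᶠ 1ᶠ) *ᵛ L x        ≡⟨ self (L x) ⟩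
      0ᵛ                           ∎))
      where
      open ≡-Reasoning
      self : ∀ {k} (z : Vec (𝔽 p) k) → z +ᵛ (-ᶠ 1ᶠ) *ᵛ z ≡ 0ᵛ
      self []      = refl
      self (a ∷ z) = cong₂ _∷_ (subtract-self a) (self z)

  -- The unit vectors of the coordinate space.
  standardBasis : ∀ k → Vec (Vec (𝔽 p) k) k
  standardBasis zero    = []
  standardBasis (suc k) = (1ᶠ ∷ 0ᵛ) ∷ Vec.map (0ᶠ ∷_) (standardBasis k)

  prepend-zero-linear : ∀ {k} → IsLinearMap {k} (0ᶠ ∷_)
  prepend-zero-linear = record
    { L-+ = λ x y → cong (_∷ (x +ᵛ y)) (sym (+ᶠ-identityˡ 0ᶠ))
    ; L-* = λ b x → cong (_∷ (b *ᵛ x)) (sym (*ᶠ-zeroʳ b)) }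

  combination-standardBasis : ∀ {k} (a : Vec (𝔽 p) k) → combination a (standardBasis k) ≡ a
  combination-standardBasis []      = refl
  combination-standardBasis {suc k} (c ∷ a) = begin
    c *ᵛ (1ᶠ ∷ 0ᵛ) +ᵛ combination a (Vec.map (0ᶠ ∷_) (standardBasis k))
      ≡⟨ cong₂ _+ᵛ_ (cong₂ _∷_ (*ᶠ-identityʳ c) (*ᵛ-zeroʳ c)) (L-combination a (standardBasis k)) ⟩
    (c ∷ 0ᵛ) +ᵛ (0ᶠ ∷ combination a (standardBasis k))
      ≡⟨ cong₂ _∷_ (+ᶠ-identityʳ c) (trans (+ᵛ-identityˡ _) (combination-standardBasis a)) ⟩
    c ∷ a ∎
    where
    open ≡-Reasoning
    open IsLinearMap (prepend-zero-linear {k})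

  length-nonzeroVecs : ∀ n → length (nonzeroVecs p n) ≡ p ^ n ∸ 1
  length-nonzeroVecs n = begin
    length (nonzeroVecs p n)
      ≡⟨ length-filter-∑ nonzero? (allVecs p n) ⟩
    ∑ (allVecs p n) (λ x → 𝟙 (nonzero? x))
      ≡⟨ ∑-constant-off _≟ⱽ_ (allVecs-enumerates n) (λ x → 𝟙 (nonzero? x)) 0ᵛ 1 (λ x → 𝟙-yes (nonzero? x)) ⟩
    𝟙 (nonzero? {n = n} 0ᵛ) + (length (allVecs p n) ∸ 1) * 1
      ≡⟨ cong₂ (λ a l → a + (l ∸ 1) * 1) (𝟙-no (nonzero? {n = n} 0ᵛ) (λ e → e refl)) (length-allVecs n) ⟩
    (p ^ n ∸ 1) * 1
      ≡⟨ *-identityʳ _ ⟩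
    p ^ n ∸ 1 ∎
    where open ≡-Reasoning

  module _ {n : ℕ} (f : Vec (𝔽 p) n → 𝔽 p) where

    private
      N : ℕ
      N = length (nonzeroVecs p n)

    -- The codeword of a message (s , u); the message space has one dimension more than the domain of f.
    encode : Vec (𝔽 p) (suc n) → Vec (𝔽 p) N
    encode (s ∷ u) = codeword f s u

    encode∈𝒞 : ∀ a → 𝒞 f (encode a)
    encode∈𝒞 (s ∷ u) = s , u , refl

    encode-linear : IsLinearMap encode
    encode-linear = record { L-+ = add ; L-* = scale }
      where
      open ≡-Reasoning
      add : ∀ x y → encode (x +ᵛ y) ≡ encode x +ᵛ encode y
      add (s ∷ u) (t ∷ v) = sym (trans (map-+ᵛ _ _ (fromList (nonzeroVecs p n))) (Vec-map-cong (λ x → begin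
        s *ᶠ f x +ᶠ u ∙ x +ᶠ (t *ᶠ f x +ᶠ v ∙ x)      ≡⟨ +ᶠ-interchange (s *ᶠ f x) _ _ _ ⟩
        s *ᶠ f x +ᶠ t *ᶠ f x +ᶠ (u ∙ x +ᶠ v ∙ x)      ≡⟨ cong₂ _+ᶠ_ (*ᶠ-distribʳ (f x) s t) (∙-+ˡ u v x) ⟨
        (s +ᶠ t) *ᶠ f x +ᶠ (u +ᵛ v) ∙ x               ∎) (fromList (nonzeroVecs p n))))
      scale : ∀ a x → encode (a *ᵛ x) ≡ a *ᵛ encode x
      scale a (s ∷ u) = sym (trans (map-*ᵛ a _ (fromList (nonzeroVecs p n))) (Vec-map-cong (λ x → begin
        a *ᶠ (s *ᶠ f x +ᶠ u ∙ x)                      ≡⟨ *ᶠ-distribˡ a _ _ ⟩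
        a *ᶠ (s *ᶠ f x) +ᶠ a *ᶠ (u ∙ x)               ≡⟨ cong₂ _+ᶠ_ (*ᶠ-assoc a s (f x)) (∙-*ˡ a u x) ⟨
        (a *ᶠ s) *ᶠ f x +ᶠ (a *ᵛ u) ∙ x               ∎) (fromList (nonzeroVecs p n))))

    open IsLinearMap encode-linear

    𝒞-linear : IsLinear (𝒞 f)
    𝒞-linear = record
      { 0-closed = subst (𝒞 f) L-0 (encode∈𝒞 0ᵛ)
      ; +-closed = λ { (s , u , refl) (t , v , refl) → subst (𝒞 f) (L-+ (s ∷ u) (t ∷ v)) (encode∈𝒞 ((s ∷ u) +ᵛ (t ∷ v))) }
      ; *-closed = λ { a (s , u , refl) → subst (𝒞 f) (L-* a (s ∷ u)) (encode∈𝒞 (a *ᵛ (s ∷ u))) } }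

    -- Inclusion of supports, read as inclusion of zeros at the points of the domain.
    zeros-included : ∀ {s u s′ u′} → supp (codeword f s′ u′) ⊆ₛ supp (codeword f s u) →
      ∀ x → x ≢ 0ᵛ → s *ᶠ f x +ᶠ u ∙ x ≡ 0ᶠ → s′ *ᶠ f x +ᶠ u′ ∙ x ≡ 0ᶠ
    zeros-included sub x x≢0 = supp-⊆-map (nonzeroVecs p n) _ _ sub
      (∈-filter⁺ nonzero? (complete (allVecs-enumerates n) x) x≢0)

    module _ (kernel-trivial : ∀ a → encode a ≡ 0ᵛ → a ≡ 0ᵛ) where

      𝒞-dimension : HasDimension (𝒞 f) (suc n)
      𝒞-dimension = record
        { basis       = Vec.map encode (standardBasis (suc n))
        ; inside      = VecAll.map⁺ (VecAll.universal encode∈𝒞 (standardBasis (suc n)))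
        ; independent = λ a eq → kernel-trivial a (trans (sym (combine a)) eq)
        ; spanning    = λ { (s , u , refl) → s ∷ u , sym (combine (s ∷ u)) } }
        where
        combine : ∀ a → combination a (Vec.map encode (standardBasis (suc n))) ≡ encode a
        combine a = trans (L-combination a (standardBasis (suc n))) (cong encode (combination-standardBasis a))

      𝒞-minDistance : ∀ {d} a → a ≢ 0ᵛ → wt (encode a) ≡ d → (∀ b → b ≢ 0ᵛ → d ≤ wt (encode b)) →
                      HasMinDistance (𝒞 f) d
      𝒞-minDistance {d} a a≢0 wt≡d lower = record
        { attained = encode a , encode 0ᵛ , encode∈𝒞 a , encode∈𝒞 0ᵛ ,
            (λ eq → a≢0 (kernel-trivial⇒injective kernel-trivial eq)) ,
            trans (dist-encode a 0ᵛ) (trans (cong (λ b → wt (encode b))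
              (trans (cong (a +ᵛ_) (*ᵛ-zeroʳ (-ᶠ 1ᶠ))) (+ᵛ-identityʳ a))) wt≡d)
        ; bound = λ { (s , u , refl) (t , v , refl) c≢c′ →
            subst (d ≤_) (sym (dist-encode (s ∷ u) (t ∷ v)))
              (lower _ (λ eq → c≢c′ (cong encode (vec-difference (s ∷ u) (t ∷ v) eq)))) } }
        where
        dist-encode : ∀ a b → dist (encode a) (encode b) ≡ wt (encode (a +ᵛ (-ᶠ 1ᶠ) *ᵛ b))
        dist-encode a b = trans (dist-wt (encode a) (encode b))
          (cong wt (sym (trans (L-+ a _) (cong (encode a +ᵛ_) (L-* (-ᶠ 1ᶠ) b)))))

  -- Counting with the ideal

  wt-map : ∀ {A : Set} (xs : List A) (g : A → 𝔽 p) →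
    wt (Vec.map g (fromList xs)) ≡ ∑ xs (λ x → 𝟙 (¬? (g x Fin.≟ 0ᶠ)))
  wt-map []       g = refl
  wt-map (x ∷ xs) g with g x Fin.≟ 0ᶠ
  ... | yes _ = wt-map xs g
  ... | no  _ = cong suc (wt-map xs g)

  -- The position 0, which the code omits, would carry the entry 0.
  wt-codeword : ∀ {n} (f : Vec (𝔽 p) n → 𝔽 p) → f 0ᵛ ≡ 0ᶠ → ∀ s u →
    wt (codeword f s u) ≡ ∑ (allVecs p n) (λ x → 𝟙 (¬? (s *ᶠ f x +ᶠ u ∙ x Fin.≟ 0ᶠ)))
  wt-codeword {n} f f0≡0 s u = begin
    wt (codeword f s u)
      ≡⟨ wt-map (nonzeroVecs p n) entry ⟩
    ∑ (filter nonzero? (allVecs p n)) count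
      ≡⟨ ∑-filter nonzero? (allVecs p n) count ⟩
    ∑ (allVecs p n) (λ x → 𝟙 (nonzero? x) * count x)
      ≡⟨ cong (_+ ∑ (allVecs p n) (λ x → 𝟙 (nonzero? x) * count x)) (𝟙-no (¬? (entry 0ᵛ Fin.≟ 0ᶠ)) (λ e → e entry0≡0)) ⟨
    count 0ᵛ + ∑ (allVecs p n) (λ x → 𝟙 (nonzero? x) * count x)
      ≡⟨ ∑-split _≟ⱽ_ (allVecs-enumerates n) count 0ᵛ ⟨
    ∑ (allVecs p n) count ∎
    where
    open ≡-Reasoning
    entry : Vec (𝔽 p) n → 𝔽 p
    entry x = s *ᶠ f x +ᶠ u ∙ x
    count : Vec (𝔽 p) n → ℕ
    count x = 𝟙 (¬? (entry x Fin.≟ 0ᶠ))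
    entry0≡0 : entry 0ᵛ ≡ 0ᶠ
    entry0≡0 = trans (cong₂ _+ᶠ_ (trans (cong (s *ᶠ_) f0≡0) (*ᶠ-zeroʳ s)) (∙-zeroʳ u)) (+ᶠ-identityˡ 0ᶠ)

  -- The number of nonzero x with c + v ∙ x = 0.
  #zeros : ∀ {k} → 𝔽 p → Vec (𝔽 p) k → ℕ
  #zeros {k} c v = ∑ (allVecs p k) (λ x → 𝟙 (nonzero? x) * 𝟙 (c +ᶠ v ∙ x Fin.≟ 0ᶠ))

  #zeros-split : ∀ {k} c (v : Vec (𝔽 p) k) →
    𝟙 (c Fin.≟ 0ᶠ) + #zeros c v ≡ ∑ (allVecs p k) (λ x → 𝟙 (c +ᶠ v ∙ x Fin.≟ 0ᶠ))
  #zeros-split {k} c v = begin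
    𝟙 (c Fin.≟ 0ᶠ) + #zeros c v
      ≡⟨ cong (λ t → 𝟙 (t Fin.≟ 0ᶠ) + #zeros c v) (trans (cong (c +ᶠ_) (∙-zeroʳ v)) (+ᶠ-identityʳ c)) ⟨
    𝟙 (c +ᶠ v ∙ 0ᵛ Fin.≟ 0ᶠ) + #zeros c v
      ≡⟨ ∑-split _≟ⱽ_ (allVecs-enumerates k) (λ x → 𝟙 (c +ᶠ v ∙ x Fin.≟ 0ᶠ)) 0ᵛ ⟨
    ∑ (allVecs p k) (λ x → 𝟙 (c +ᶠ v ∙ x Fin.≟ 0ᶠ)) ∎
    where open ≡-Reasoning

  -- For v = 0 the form is the constant c.
  #zeros-constant : ∀ k c → 𝟙 (c Fin.≟ 0ᶠ) + #zeros c (0ᵛ {n = k}) ≡ p ^ k * 𝟙 (c Fin.≟ 0ᶠ)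
  #zeros-constant k c = begin
    𝟙 (c Fin.≟ 0ᶠ) + #zeros c (0ᵛ {n = k})
      ≡⟨ #zeros-split {k} c 0ᵛ ⟩
    ∑ (allVecs p k) (λ x → 𝟙 (c +ᶠ 0ᵛ ∙ x Fin.≟ 0ᶠ))
      ≡⟨ ∑-cong (allVecs p k) (λ x → cong (λ t → 𝟙 (t Fin.≟ 0ᶠ)) (trans (cong (c +ᶠ_) (∙-zeroˡ x)) (+ᶠ-identityʳ c))) ⟩
    ∑ (allVecs p k) (λ x → 𝟙 (c Fin.≟ 0ᶠ))
      ≡⟨ ∑-const (allVecs p k) _ ⟩
    length (allVecs p k) * 𝟙 (c Fin.≟ 0ᶠ)
      ≡⟨ cong (_* 𝟙 (c Fin.≟ 0ᶠ)) (length-allVecs k) ⟩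
    p ^ k * 𝟙 (c Fin.≟ 0ᶠ) ∎
    where open ≡-Reasoning

  #zeros-00 : ∀ k → 1 + #zeros 0ᶠ (0ᵛ {n = k}) ≡ p ^ k
  #zeros-00 k = begin
    1 + #zeros 0ᶠ (0ᵛ {n = k})                     ≡⟨ cong (_+ #zeros 0ᶠ (0ᵛ {n = k})) 𝟙≡1 ⟨
    𝟙 (0ᶠ Fin.≟ 0ᶠ) + #zeros 0ᶠ (0ᵛ {n = k})       ≡⟨ #zeros-constant k 0ᶠ ⟩
    p ^ k * 𝟙 (0ᶠ Fin.≟ 0ᶠ)                        ≡⟨ cong (p ^ k *_) 𝟙≡1 ⟩
    p ^ k * 1                                      ≡⟨ *-identityʳ _ ⟩
    p ^ k                                          ∎
    where
    open ≡-Reasoning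
    𝟙≡1 : 𝟙 (0ᶠ {p} Fin.≟ 0ᶠ) ≡ 1
    𝟙≡1 = 𝟙-yes (0ᶠ {p} Fin.≟ 0ᶠ) refl

  #zeros-≢0 : ∀ k {c} → c ≢ 0ᶠ → #zeros c (0ᵛ {n = k}) ≡ 0
  #zeros-≢0 k {c} c≢0 = m+n≡0⇒n≡0 _ (begin
    𝟙 (c Fin.≟ 0ᶠ) + #zeros c (0ᵛ {n = k})    ≡⟨ #zeros-constant k c ⟩
    p ^ k * 𝟙 (c Fin.≟ 0ᶠ)                    ≡⟨ cong (p ^ k *_) (𝟙-no (c Fin.≟ 0ᶠ) c≢0) ⟩
    p ^ k * 0                                 ≡⟨ *-zeroʳ (p ^ k) ⟩
    0                                         ∎)
    where open ≡-Reasoning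

  module _ (isPrime : Prime p) where

    #zeros-nonconstant : ∀ {k} c {v : Vec (𝔽 p) (suc k)} → v ≢ 0ᵛ → 𝟙 (c Fin.≟ 0ᶠ) + #zeros c v ≡ p ^ k
    #zeros-nonconstant {k} c {v} v≢0 = begin
      𝟙 (c Fin.≟ 0ᶠ) + #zeros c v
        ≡⟨ #zeros-split c v ⟩
      ∑ (allVecs p (suc k)) (λ x → 𝟙 (c +ᶠ v ∙ x Fin.≟ 0ᶠ))
        ≡⟨ equidistribution isPrime v v≢0 (λ t → 𝟙 (c +ᶠ t Fin.≟ 0ᶠ)) ⟩
      p ^ k * ∑ (allFin p) (λ t → 𝟙 (c +ᶠ t Fin.≟ 0ᶠ))
        ≡⟨ cong (p ^ k *_) (∑-cong (allFin p) pointwise) ⟩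
      p ^ k * ∑ (allFin p) (λ t → 𝟙 (t Fin.≟ -ᶠ c) * 1)
        ≡⟨ cong (p ^ k *_) (∑-single Fin._≟_ allFin-enumerates (λ _ → 1) (-ᶠ c)) ⟩
      p ^ k * 1
        ≡⟨ *-identityʳ _ ⟩
      p ^ k ∎
      where
      open ≡-Reasoning
      pointwise : ∀ t → 𝟙 (c +ᶠ t Fin.≟ 0ᶠ) ≡ 𝟙 (t Fin.≟ -ᶠ c) * 1
      pointwise t = trans (𝟙-cong (c +ᶠ t Fin.≟ 0ᶠ) (t Fin.≟ -ᶠ c)
        (λ eq → -ᶠ-uniqueʳ c t eq) (λ { refl → +ᶠ-inverseʳ c })) (sym (*-identityʳ _))

    #zeros-form : ∀ {k} {v : Vec (𝔽 p) (suc k)} → v ≢ 0ᵛ → 1 + #zeros 0ᶠ v ≡ p ^ k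
    #zeros-form {k} {v} v≢0 = trans
      (cong (_+ #zeros 0ᶠ v) (sym (𝟙-yes (0ᶠ {p} Fin.≟ 0ᶠ) refl))) (#zeros-nonconstant 0ᶠ v≢0)

    #zeros-affine : ∀ {k} {c} {v : Vec (𝔽 p) (suc k)} → c ≢ 0ᶠ → v ≢ 0ᵛ → #zeros c v ≡ p ^ k
    #zeros-affine {k} {c} {v} c≢0 v≢0 = trans
      (cong (_+ #zeros c v) (sym (𝟙-no (c Fin.≟ 0ᶠ) c≢0))) (#zeros-nonconstant c v≢0)

    #nonzeros : ∀ {k} {u : Vec (𝔽 p) (suc k)} → u ≢ 0ᵛ →
      ∑ (allVecs p (suc k)) (λ x → 𝟙 (¬? (u ∙ x Fin.≟ 0ᶠ))) ≡ (p ∸ 1) * p ^ k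
    #nonzeros {k} {u} u≢0 = begin
      ∑ (allVecs p (suc k)) (λ x → 𝟙 (¬? (u ∙ x Fin.≟ 0ᶠ)))
        ≡⟨ equidistribution isPrime u u≢0 _ ⟩
      p ^ k * ∑ (allFin p) (λ t → 𝟙 (¬? (t Fin.≟ 0ᶠ)))
        ≡⟨ cong (p ^ k *_) (∑-constant-off Fin._≟_ allFin-enumerates _ 0ᶠ 1 (λ t → 𝟙-yes (¬? (t Fin.≟ 0ᶠ)))) ⟩
      p ^ k * (𝟙 (¬? (0ᶠ {p} Fin.≟ 0ᶠ)) + (length (allFin p) ∸ 1) * 1)
        ≡⟨ cong₂ (λ a b → p ^ k * (a + (b ∸ 1) * 1)) (𝟙-no (¬? (0ᶠ {p} Fin.≟ 0ᶠ)) (λ e → e refl)) length-allFin ⟩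
      p ^ k * ((p ∸ 1) * 1)
        ≡⟨ cong (p ^ k *_) (*-identityʳ (p ∸ 1)) ⟩
      p ^ k * (p ∸ 1)
        ≡⟨ *-comm (p ^ k) _ ⟩
      (p ∸ 1) * p ^ k ∎
      where open ≡-Reasoning

  -- The vector (-1,…,-1), the full multiset on k elements.
  minusOnes : ∀ k → Vec (𝔽 p) k
  minusOnes k = replicate k [ p ∸ 1 ]ᶠ

  -- f is the indicator of S = { x ++ 0 : x ≠ 0 } ∪ { (-1,…,-1) ++ y : y ≠ 0 }. The two pieces are
  -- disjoint and do not contain 0. Values at x ++ 0 with x = 0 are covered by at-zero.
  record IsIdealIndicator m r (f : Vec (𝔽 p) (m + r) → 𝔽 p) : Set where
    field
      at-zero  : f 0ᵛ ≡ 0ᶠ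
      on-left  : ∀ {v : Vec (𝔽 p) m} → v ≢ 0ᵛ → f (v ++ 0ᵛ) ≡ 1ᶠ
      on-right : ∀ {w : Vec (𝔽 p) r} → w ≢ 0ᵛ → f (minusOnes m ++ w) ≡ 1ᶠ
      off      : ∀ {v : Vec (𝔽 p) m} {w : Vec (𝔽 p) r} → w ≢ 0ᵛ → v ≢ minusOnes m → f (v ++ w) ≡ 0ᶠ

  module _ {m r : ℕ} where

    -- The indicator of S as a natural number, one summand for each piece.
    inIdeal : Vec (𝔽 p) m → Vec (𝔽 p) r → ℕ
    inIdeal x y = 𝟙 (y ≟ⱽ 0ᵛ) * 𝟙 (nonzero? x) + 𝟙 (nonzero? y) * 𝟙 (x ≟ⱽ minusOnes m)

    -- A sum over S is the sum over its two pieces.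
    ∑-ideal : ∀ (g : Vec (𝔽 p) (m + r) → ℕ) →
      ∑ (allVecs p m) (λ x → ∑ (allVecs p r) (λ y → inIdeal x y * g (x ++ y))) ≡
      ∑ (allVecs p m) (λ x → 𝟙 (nonzero? x) * g (x ++ 0ᵛ)) +
      ∑ (allVecs p r) (λ y → 𝟙 (nonzero? y) * g (minusOnes m ++ y))
    ∑-ideal g = begin
      ∑ Vm (λ x → ∑ Vr (λ y → inIdeal x y * g (x ++ y)))
        ≡⟨ ∑-cong Vm inner ⟩
      ∑ Vm (λ x → 𝟙 (nonzero? x) * g (x ++ 0ᵛ) + 𝟙 (x ≟ⱽ minusOnes m) * right x)
        ≡⟨ ∑-+ Vm _ _ ⟩
      ∑ Vm (λ x → 𝟙 (nonzero? x) * g (x ++ 0ᵛ)) + ∑ Vm (λ x → 𝟙 (x ≟ⱽ minusOnes m) * right x)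
        ≡⟨ cong (∑ Vm (λ x → 𝟙 (nonzero? x) * g (x ++ 0ᵛ)) +_)
             (∑-single _≟ⱽ_ (allVecs-enumerates m) right (minusOnes m)) ⟩
      ∑ Vm (λ x → 𝟙 (nonzero? x) * g (x ++ 0ᵛ)) + right (minusOnes m) ∎
      where
      open ≡-Reasoning
      Vm = allVecs p m
      Vr = allVecs p r
      right : Vec (𝔽 p) m → ℕ
      right x = ∑ Vr (λ y → 𝟙 (nonzero? y) * g (x ++ y))
      rearrange : ∀ a b c d t → (a * b + c * d) * t ≡ a * (b * t) + d * (c * t)
      rearrange = solve-∀
      inner : ∀ x → ∑ Vr (λ y → inIdeal x y * g (x ++ y)) ≡
                    𝟙 (nonzero? x) * g (x ++ 0ᵛ) + 𝟙 (x ≟ⱽ minusOnes m) * right x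
      inner x = begin
        ∑ Vr (λ y → inIdeal x y * g (x ++ y))
          ≡⟨ ∑-cong Vr (λ y → rearrange (𝟙 (y ≟ⱽ 0ᵛ)) (𝟙 (nonzero? x))
               (𝟙 (nonzero? y)) (𝟙 (x ≟ⱽ minusOnes m)) (g (x ++ y))) ⟩
        ∑ Vr (λ y → 𝟙 (y ≟ⱽ 0ᵛ) * (𝟙 (nonzero? x) * g (x ++ y)) +
                    𝟙 (x ≟ⱽ minusOnes m) * (𝟙 (nonzero? y) * g (x ++ y)))
          ≡⟨ ∑-+ Vr _ _ ⟩
        ∑ Vr (λ y → 𝟙 (y ≟ⱽ 0ᵛ) * (𝟙 (nonzero? x) * g (x ++ y))) +
        ∑ Vr (λ y → 𝟙 (x ≟ⱽ minusOnes m) * (𝟙 (nonzero? y) * g (x ++ y)))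
          ≡⟨ cong₂ _+_ (∑-single _≟ⱽ_ (allVecs-enumerates r) (λ y → 𝟙 (nonzero? x) * g (x ++ y)) 0ᵛ)
                       (∑-*ˡ Vr (𝟙 (x ≟ⱽ minusOnes m)) _) ⟩
        𝟙 (nonzero? x) * g (x ++ 0ᵛ) + 𝟙 (x ≟ⱽ minusOnes m) * right x ∎

    module _ {f : Vec (𝔽 p) (m + r) → 𝔽 p} (ind : IsIdealIndicator m r f) where
      open IsIdealIndicator ind

      indicator-value : ∀ x y →
        (f (x ++ y) ≡ 1ᶠ × inIdeal x y ≡ 1) ⊎ (f (x ++ y) ≡ 0ᶠ × inIdeal x y ≡ 0)
      indicator-value x y with y ≟ⱽ 0ᵛ | x ≟ⱽ 0ᵛ | x ≟ⱽ minusOnes m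
      ... | yes refl | yes refl | _        = inj₂ (trans (cong f (++-zero m r)) at-zero , refl)
      ... | yes refl | no x≢0   | _        = inj₁ (on-left x≢0 , refl)
      ... | no y≢0   | _        | yes refl = inj₁ (on-right y≢0 , refl)
      ... | no y≢0   | _        | no x≢-1  = inj₂ (off y≢0 x≢-1 , refl)

      -- Pointwise: off S both sides count a nonzero value of u ∙ x, and on S both sides are 1, since
      -- each of s + u ∙ x and u ∙ x is either zero or nonzero.
      wt-relation : ∀ s v w →
        wt (codeword f s (v ++ w)) + (#zeros s v + #zeros (s +ᶠ v ∙ minusOnes m) w) ≡
        ∑ (allVecs p (m + r)) (λ x → 𝟙 (¬? ((v ++ w) ∙ x Fin.≟ 0ᶠ))) +
          (#zeros 0ᶠ v + #zeros (v ∙ minusOnes m) w)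
      wt-relation s v w = begin
        wt (codeword f s u) + (#zeros s v + #zeros (s +ᶠ v ∙ minusOnes m) w)
          ≡⟨ cong₂ _+_ (wt-codeword f at-zero s u) (ideal-zeros s) ⟩
        ∑ (allVecs p (m + r)) entry + ∑ Vm (λ x → ∑ Vr (λ y → inIdeal x y * zero-at s (x ++ y)))
          ≡⟨ cong (_+ ∑ Vm (λ x → ∑ Vr (λ y → inIdeal x y * zero-at s (x ++ y)))) (∑-++-split m r entry) ⟩
        ∑ Vm (λ x → ∑ Vr (λ y → entry (x ++ y))) + ∑ Vm (λ x → ∑ Vr (λ y → inIdeal x y * zero-at s (x ++ y)))
          ≡⟨ combine entry (zero-at s) ⟨
        ∑ Vm (λ x → ∑ Vr (λ y → entry (x ++ y) + inIdeal x y * zero-at s (x ++ y)))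
          ≡⟨ ∑-cong Vm (λ x → ∑-cong Vr (λ y → pointwise x y)) ⟩
        ∑ Vm (λ x → ∑ Vr (λ y → linear (x ++ y) + inIdeal x y * zero-at 0ᶠ (x ++ y)))
          ≡⟨ combine linear (zero-at 0ᶠ) ⟩
        ∑ Vm (λ x → ∑ Vr (λ y → linear (x ++ y))) + ∑ Vm (λ x → ∑ Vr (λ y → inIdeal x y * zero-at 0ᶠ (x ++ y)))
          ≡⟨ cong₂ _+_ (∑-++-split m r linear) (ideal-zeros 0ᶠ) ⟨
        ∑ (allVecs p (m + r)) linear + (#zeros 0ᶠ v + #zeros (0ᶠ +ᶠ v ∙ minusOnes m) w)
          ≡⟨ cong (λ t → ∑ (allVecs p (m + r)) linear + (#zeros 0ᶠ v + #zeros t w)) (+ᶠ-identityˡ _) ⟩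
        ∑ (allVecs p (m + r)) linear + (#zeros 0ᶠ v + #zeros (v ∙ minusOnes m) w) ∎
        where
        open ≡-Reasoning
        u = v ++ w
        Vm = allVecs p m
        Vr = allVecs p r
        entry linear : Vec (𝔽 p) (m + r) → ℕ
        entry x = 𝟙 (¬? (s *ᶠ f x +ᶠ u ∙ x Fin.≟ 0ᶠ))
        linear x = 𝟙 (¬? (u ∙ x Fin.≟ 0ᶠ))
        zero-at : 𝔽 p → Vec (𝔽 p) (m + r) → ℕ
        zero-at c x = 𝟙 (c +ᶠ u ∙ x Fin.≟ 0ᶠ)

        combine : ∀ (g h : Vec (𝔽 p) (m + r) → ℕ) →
          ∑ Vm (λ x → ∑ Vr (λ y → g (x ++ y) + inIdeal x y * h (x ++ y))) ≡
          ∑ Vm (λ x → ∑ Vr (λ y → g (x ++ y))) + ∑ Vm (λ x → ∑ Vr (λ y → inIdeal x y * h (x ++ y)))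
        combine g h = trans (∑-cong Vm (λ x → ∑-+ Vr (λ y → g (x ++ y)) (λ y → inIdeal x y * h (x ++ y)))) (∑-+ Vm _ _)

        ideal-zeros : ∀ c → #zeros c v + #zeros (c +ᶠ v ∙ minusOnes m) w ≡
                            ∑ Vm (λ x → ∑ Vr (λ y → inIdeal x y * zero-at c (x ++ y)))
        ideal-zeros c = sym (trans (∑-ideal (zero-at c)) (cong₂ _+_
          (∑-cong Vm (λ x → cong (λ t → 𝟙 (nonzero? x) * 𝟙 (c +ᶠ t Fin.≟ 0ᶠ))
            (trans (∙-++ v x w 0ᵛ) (trans (cong (v ∙ x +ᶠ_) (∙-zeroʳ w)) (+ᶠ-identityʳ _)))))
          (∑-cong Vr (λ y → cong (λ t → 𝟙 (nonzero? y) * 𝟙 (t Fin.≟ 0ᶠ))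
            (trans (cong (c +ᶠ_) (∙-++ v (minusOnes m) w y)) (sym (+ᶠ-assoc c _ _)))))))

        pointwise : ∀ x y → entry (x ++ y) + inIdeal x y * zero-at s (x ++ y) ≡
                            linear (x ++ y) + inIdeal x y * zero-at 0ᶠ (x ++ y)
        pointwise x y = by-value (indicator-value x y)
          where
          z = u ∙ (x ++ y)
          by-value : (f (x ++ y) ≡ 1ᶠ × inIdeal x y ≡ 1) ⊎ (f (x ++ y) ≡ 0ᶠ × inIdeal x y ≡ 0) →
            entry (x ++ y) + inIdeal x y * zero-at s (x ++ y) ≡
            linear (x ++ y) + inIdeal x y * zero-at 0ᶠ (x ++ y)
          by-value (inj₁ (f≡1 , i≡1)) rewrite f≡1 | i≡1 | *ᶠ-identityʳ s | +ᶠ-identityˡ z =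
            trans (balance (s +ᶠ z)) (sym (balance z))
            where
            balance : ∀ t → 𝟙 (¬? (t Fin.≟ 0ᶠ)) + 1 * 𝟙 (t Fin.≟ 0ᶠ) ≡ 1
            balance t = trans (cong (𝟙 (¬? (t Fin.≟ 0ᶠ)) +_) (*-identityˡ _))
              (trans (+-comm _ (𝟙 (t Fin.≟ 0ᶠ))) (𝟙-¬ (t Fin.≟ 0ᶠ)))
          by-value (inj₂ (f≡0 , i≡0)) rewrite f≡0 | i≡0 | *ᶠ-zeroʳ s | +ᶠ-identityˡ z = refl

  -- The weights of the codewords

  ++-zero⁻ : ∀ {j k} (v : Vec (𝔽 p) j) {w : Vec (𝔽 p) k} → v ++ w ≡ 0ᵛ → v ≡ 0ᵛ × w ≡ 0ᵛ
  ++-zero⁻ {j} {k} v eq = ++-injective v 0ᵛ (trans eq (sym (++-zero j k)))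

  minusOnes≢0 : Prime p → ∀ k → minusOnes (suc k) ≢ 0ᵛ
  minusOnes≢0 pr k eq = []≢[] (≤-reflexive (suc-pred p)) (>-nonZero⁻¹ p) p∸1≢0 (proj₁ (∷-injective eq))
    where
    p∸1≢0 : p ∸ 1 ≢ 0
    p∸1≢0 e = <⇒≱ (nonTrivial⇒n>1 p {{prime⇒nonTrivial pr}}) (m∸n≡0⇒m≤n e)

  private
    weight-arithmetic : ∀ W U x y k l → W + x ≡ U + y → k + x ≡ l + y → W ≡ U + k ∸ l
    weight-arithmetic W U x y k l eq₁ eq₂ = begin
      W              ≡⟨ m+n∸n≡m W l ⟨
      W + l ∸ l      ≡⟨ cong (_∸ l) (+-cancelʳ-≡ y (W + l) (U + k) shifted) ⟩
      U + k ∸ l      ∎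
      where
      open ≡-Reasoning
      left-comm : ∀ a b c → a + (b + c) ≡ b + (a + c)
      left-comm = solve-∀
      shifted : W + l + y ≡ U + k + y
      shifted = begin
        W + l + y      ≡⟨ +-assoc W l y ⟩
        W + (l + y)    ≡⟨ cong (W +_) eq₂ ⟨
        W + (k + x)    ≡⟨ left-comm W k x ⟩
        k + (W + x)    ≡⟨ cong (k +_) eq₁ ⟩
        k + (U + y)    ≡⟨ left-comm k U y ⟩
        U + (k + y)    ≡⟨ +-assoc U k y ⟨
        U + k + y      ∎

  -- The exponents are m = m′ + 1 and r = r′ + 1. Counting the zeros of a nonzero form in m variables
  -- gives p ^ m′, and Q = (p - 1) p ^ (n - 1) is the weight of a nonzero linear form.
  module Weights (isPrime : Prime p) {m′ r′ : ℕ} {f : Vec (𝔽 p) (suc m′ + suc r′) → 𝔽 p}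
                 (ind : IsIdealIndicator (suc m′) (suc r′) f) where

    m r Q : ℕ
    m = suc m′
    r = suc r′
    Q = (p ∸ 1) * p ^ (m′ + r)

    -- The value of the linear form v at (-1,…,-1): the second piece of S sees w shifted by τ v.
    τ : Vec (𝔽 p) m → 𝔽 p
    τ v = v ∙ minusOnes m

    0ᵐ : Vec (𝔽 p) m
    0ᵐ = 0ᵛ

    0ʳ : Vec (𝔽 p) r
    0ʳ = 0ᵛ

    -- The number of points where the linear form u does not vanish.
    #support : Vec (𝔽 p) (m + r) → ℕ
    #support u = ∑ (allVecs p (m + r)) (λ x → 𝟙 (¬? (u ∙ x Fin.≟ 0ᶠ)))

    private
      -- wt-relation solved for the weight, given the five counts.
      weight : ∀ s v w {a b c d e} k l →
        #zeros s v ≡ a → #zeros (s +ᶠ τ v) w ≡ b → #support (v ++ w) ≡ c →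
        #zeros 0ᶠ v ≡ d → #zeros (τ v) w ≡ e → k + (a + b) ≡ l + (d + e) →
        wt (codeword f s (v ++ w)) ≡ c + k ∸ l
      weight s v w k l refl refl refl refl refl = weight-arithmetic _ (#support (v ++ w))
        (#zeros s v + #zeros (s +ᶠ τ v) w) (#zeros 0ᶠ v + #zeros (τ v) w) k l (wt-relation ind s v w)

      -- The case u ≠ 0, whose linear form has a support of Q points, with k = 0.
      weight-Q : ∀ s v w {a b d e} l → (v ≢ 0ᵐ ⊎ w ≢ 0ʳ) →
        #zeros s v ≡ a → #zeros (s +ᶠ τ v) w ≡ b →
        #zeros 0ᶠ v ≡ d → #zeros (τ v) w ≡ e → a + b ≡ l + (d + e) →
        wt (codeword f s (v ++ w)) ≡ Q ∸ l

      #support-≢0 : ∀ v w → (v ≢ 0ᵐ ⊎ w ≢ 0ʳ) → #support (v ++ w) ≡ Q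
      #support-≢0 v w (inj₁ v≢0) = #nonzeros isPrime (λ eq → v≢0 (proj₁ (++-zero⁻ {m} {r} v eq)))
      #support-≢0 v w (inj₂ w≢0) = #nonzeros isPrime (λ eq → w≢0 (proj₂ (++-zero⁻ {m} {r} v eq)))

      weight-Q s v w l vw≢0 e₁ e₂ e₃ e₄ eq = trans
        (weight s v w 0 l e₁ e₂ (#support-≢0 v w vw≢0) e₃ e₄ eq)
        (cong (_∸ l) (+-identityʳ Q))

      τ0≡0 : τ 0ᵐ ≡ 0ᶠ
      τ0≡0 = ∙-zeroˡ (minusOnes m)

      s+τ≢0 : ∀ {s} v → s ≢ 0ᶠ → τ v ≡ 0ᶠ → s +ᶠ τ v ≢ 0ᶠ
      s+τ≢0 {s} v s≢0 τ≡0 eq = s≢0 (trans (sym (+ᶠ-identityʳ s)) (trans (cong (s +ᶠ_) (sym τ≡0)) eq))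

      τ≢0 : ∀ {s} v → s ≢ 0ᶠ → s +ᶠ τ v ≡ 0ᶠ → τ v ≢ 0ᶠ
      τ≢0 v s≢0 eq τ≡0 = s+τ≢0 v s≢0 τ≡0 eq

    -- One lemma for each case of s, v, w and τ v. Only wt-linear and wt-linear′ treat s = 0.
    wt-f : ∀ {s} → s ≢ 0ᶠ → wt (codeword f s (0ᵐ ++ 0ʳ)) ≡ p ^ m + p ^ r ∸ 2
    wt-f {s} s≢0 = weight s 0ᵐ 0ʳ (p ^ m + p ^ r) 2
      (#zeros-≢0 m s≢0) (#zeros-≢0 r (s+τ≢0 0ᵐ s≢0 τ0≡0)) none refl (cong (λ t → #zeros t 0ʳ) τ0≡0)
      (begin
        p ^ m + p ^ r + (0 + 0)                    ≡⟨ +-identityʳ _ ⟩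
        p ^ m + p ^ r                              ≡⟨ cong₂ _+_ (#zeros-00 m) (#zeros-00 r) ⟨
        1 + #zeros 0ᶠ 0ᵐ + (1 + #zeros 0ᶠ 0ʳ)      ≡⟨ cong suc (+-suc (#zeros 0ᶠ 0ᵐ) _) ⟩
        2 + (#zeros 0ᶠ 0ᵐ + #zeros 0ᶠ 0ʳ)          ∎)
      where
      open ≡-Reasoning
      none : #support (0ᵐ ++ 0ʳ) ≡ 0
      none = trans (∑-cong (allVecs p (m + r)) (λ x → 𝟙-no (¬? ((0ᵐ ++ 0ʳ) ∙ x Fin.≟ 0ᶠ))
               (λ ne → ne (trans (cong (_∙ x) (++-zero m r)) (∙-zeroˡ x)))))
             (∑-zero (allVecs p (m + r)))

    wt-linear : ∀ v w → (v ≢ 0ᵐ ⊎ w ≢ 0ʳ) → wt (codeword f 0ᶠ (v ++ w)) ≡ Q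
    wt-linear v w vw≢0 = weight-Q 0ᶠ v w 0 vw≢0
      refl (cong (λ t → #zeros t w) (+ᶠ-identityˡ (τ v))) refl refl refl

    wt-linear′ : ∀ u → u ≢ 0ᵛ → wt (codeword f 0ᶠ u) ≡ Q
    wt-linear′ u u≢0 with Vec.splitAt m u
    ... | v , w , refl with v ≟ⱽ 0ᵐ | w ≟ⱽ 0ʳ
    ...   | no v≢0   | _        = wt-linear v w (inj₁ v≢0)
    ...   | yes _    | no w≢0   = wt-linear v w (inj₂ w≢0)
    ...   | yes refl | yes refl = ⊥-elim (u≢0 (++-zero m r))

    wt-v≡0 : ∀ {s w} → s ≢ 0ᶠ → w ≢ 0ʳ → wt (codeword f s (0ᵐ ++ w)) ≡ Q + p ^ m ∸ 2
    wt-v≡0 {s} {w} s≢0 w≢0 = weight s 0ᵐ w (p ^ m) 2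
      (#zeros-≢0 m s≢0) (#zeros-affine isPrime (s+τ≢0 0ᵐ s≢0 τ0≡0) w≢0)
      (#support-≢0 0ᵐ w (inj₂ w≢0)) refl (cong (λ t → #zeros t w) τ0≡0)
      (begin
        p ^ m + p ^ r′                             ≡⟨ cong₂ _+_ (#zeros-00 m) (#zeros-form isPrime w≢0) ⟨
        1 + #zeros 0ᶠ 0ᵐ + (1 + #zeros 0ᶠ w)       ≡⟨ cong suc (+-suc (#zeros 0ᶠ 0ᵐ) _) ⟩
        2 + (#zeros 0ᶠ 0ᵐ + #zeros 0ᶠ w)           ∎)
      where open ≡-Reasoning

    module _ {s : 𝔽 p} {v : Vec (𝔽 p) m} (s≢0 : s ≢ 0ᶠ) (v≢0 : v ≢ 0ᵐ) where

      open ≡-Reasoning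

      wt-w≡0-τ≡0 : τ v ≡ 0ᶠ → wt (codeword f s (v ++ 0ʳ)) ≡ Q + p ^ r ∸ 2
      wt-w≡0-τ≡0 τ≡0 = weight s v 0ʳ (p ^ r) 2
        (#zeros-affine isPrime s≢0 v≢0) (#zeros-≢0 r (s+τ≢0 v s≢0 τ≡0))
        (#support-≢0 v 0ʳ (inj₁ v≢0)) refl (cong (λ t → #zeros t 0ʳ) τ≡0)
        (begin
          p ^ r + (p ^ m′ + 0)                       ≡⟨ cong (p ^ r +_) (+-identityʳ _) ⟩
          p ^ r + p ^ m′                             ≡⟨ +-comm (p ^ r) _ ⟩
          p ^ m′ + p ^ r                             ≡⟨ cong₂ _+_ (#zeros-form isPrime v≢0) (#zeros-00 r) ⟨
          1 + #zeros 0ᶠ v + (1 + #zeros 0ᶠ 0ʳ)       ≡⟨ cong suc (+-suc (#zeros 0ᶠ v) _) ⟩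
          2 + (#zeros 0ᶠ v + #zeros 0ᶠ 0ʳ)           ∎)

      wt-w≡0-s+τ≡0 : s +ᶠ τ v ≡ 0ᶠ → wt (codeword f s (v ++ 0ʳ)) ≡ Q ∸ p ^ r
      wt-w≡0-s+τ≡0 eq = weight-Q s v 0ʳ (p ^ r) (inj₁ v≢0)
        (#zeros-affine isPrime s≢0 v≢0) (cong (λ t → #zeros t 0ʳ) eq)
        refl (#zeros-≢0 r (τ≢0 v s≢0 eq))
        (begin
          p ^ m′ + #zeros 0ᶠ 0ʳ                 ≡⟨ cong (_+ #zeros 0ᶠ 0ʳ) (#zeros-form isPrime v≢0) ⟨
          1 + #zeros 0ᶠ v + #zeros 0ᶠ 0ʳ        ≡⟨ lemma (#zeros 0ᶠ v) (#zeros 0ᶠ 0ʳ) ⟩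
          1 + #zeros 0ᶠ 0ʳ + (#zeros 0ᶠ v + 0)  ≡⟨ cong (_+ (#zeros 0ᶠ v + 0)) (#zeros-00 r) ⟩
          p ^ r + (#zeros 0ᶠ v + 0)             ∎)
        where
        lemma : ∀ a b → 1 + a + b ≡ 1 + b + (a + 0)
        lemma = solve-∀

      wt-w≡0-generic : τ v ≢ 0ᶠ → s +ᶠ τ v ≢ 0ᶠ → wt (codeword f s (v ++ 0ʳ)) ≡ Q ∸ 1
      wt-w≡0-generic τ≢0 s+τ≢0 = weight-Q s v 0ʳ 1 (inj₁ v≢0)
        (#zeros-affine isPrime s≢0 v≢0) (#zeros-≢0 r s+τ≢0) refl (#zeros-≢0 r τ≢0)
        (cong (_+ 0) (sym (#zeros-form isPrime v≢0)))

      module _ {w : Vec (𝔽 p) r} (w≢0 : w ≢ 0ʳ) where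

        wt-w≢0-τ≡0 : τ v ≡ 0ᶠ → wt (codeword f s (v ++ w)) ≡ Q ∸ 2
        wt-w≢0-τ≡0 τ≡0 = weight-Q s v w 2 (inj₁ v≢0)
          (#zeros-affine isPrime s≢0 v≢0) (#zeros-affine isPrime (s+τ≢0 v s≢0 τ≡0) w≢0)
          refl (cong (λ t → #zeros t w) τ≡0)
          (begin
            p ^ m′ + p ^ r′                        ≡⟨ cong₂ _+_ (#zeros-form isPrime v≢0) (#zeros-form isPrime w≢0) ⟨
            1 + #zeros 0ᶠ v + (1 + #zeros 0ᶠ w)    ≡⟨ cong suc (+-suc (#zeros 0ᶠ v) _) ⟩
            2 + (#zeros 0ᶠ v + #zeros 0ᶠ w)        ∎)

        wt-w≢0-s+τ≡0 : s +ᶠ τ v ≡ 0ᶠ → wt (codeword f s (v ++ w)) ≡ Q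
        wt-w≢0-s+τ≡0 eq = weight-Q s v w 0 (inj₁ v≢0)
          (#zeros-affine isPrime s≢0 v≢0) (cong (λ t → #zeros t w) eq)
          refl (#zeros-affine isPrime (τ≢0 v s≢0 eq) w≢0)
          (begin
            p ^ m′ + #zeros 0ᶠ w             ≡⟨ cong (_+ #zeros 0ᶠ w) (#zeros-form isPrime v≢0) ⟨
            1 + #zeros 0ᶠ v + #zeros 0ᶠ w    ≡⟨ +-suc (#zeros 0ᶠ v) _ ⟨
            #zeros 0ᶠ v + suc (#zeros 0ᶠ w)  ≡⟨ cong (#zeros 0ᶠ v +_) (#zeros-form isPrime w≢0) ⟩
            #zeros 0ᶠ v + p ^ r′             ∎)

        wt-w≢0-generic : τ v ≢ 0ᶠ → s +ᶠ τ v ≢ 0ᶠ → wt (codeword f s (v ++ w)) ≡ Q ∸ 1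
        wt-w≢0-generic τ≢0 s+τ≢0 = weight-Q s v w 1 (inj₁ v≢0)
          (#zeros-affine isPrime s≢0 v≢0) (#zeros-affine isPrime s+τ≢0 w≢0)
          refl (#zeros-affine isPrime τ≢0 w≢0)
          (cong (_+ p ^ r′) (sym (#zeros-form isPrime v≢0)))

  -- The weight distribution

  module Distribution (isPrime : Prime p) {m′ r′ : ℕ} {f : Vec (𝔽 p) (suc m′ + suc r′) → 𝔽 p}
                 (ind : IsIdealIndicator (suc m′) (suc r′) f) where
    open Weights isPrime ind

    -- The table of weights and frequencies, in terms of m′ = m - 1.
    rows : List (ℕ × ℕ)
    rows = (p ^ m + p ^ r ∸ 2 , p ∸ 1)
         ∷ (Q ∸ p ^ r         , (p ∸ 1) * p ^ m′)
         ∷ (Q ∸ 2             , (p ∸ 1) * (p ^ m′ ∸ 1) * (p ^ r ∸ 1))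
         ∷ (Q ∸ 1             , (p ∸ 1) * (p ∸ 2) * p ^ (m′ + r))
         ∷ (Q                 , (p ^ (m + r) ∸ 1) + (p ∸ 1) * p ^ m′ * (p ^ r ∸ 1))
         ∷ (Q + p ^ m ∸ 2     , (p ∸ 1) * (p ^ r ∸ 1))
         ∷ (Q + p ^ r ∸ 2     , (p ∸ 1) * (p ^ m′ ∸ 1))
         ∷ []

    module _ (h : ℕ → ℕ) where

      private
        R₁ : ℕ
        R₁ = p ^ r ∸ 1

        -- The sum of h over the fibre of all w above a vector v: for v ≠ 0 with τ v equal to 0,
        -- to -s, to anything else, and for v = 0.
        A₀ Aₛ A₁ D₀ : ℕ
        A₀ = h (Q + p ^ r ∸ 2) + R₁ * h (Q ∸ 2)
        Aₛ = h (Q ∸ p ^ r) + R₁ * h Q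
        A₁ = h (Q ∸ 1) + R₁ * h (Q ∸ 1)
        D₀ = h (p ^ m + p ^ r ∸ 2) + R₁ * h (Q + p ^ m ∸ 2)

        -- The sum of h over the fibre above v ≠ 0 as a function of τ v.
        G : 𝔽 p → 𝔽 p → ℕ
        G s t with t Fin.≟ 0ᶠ | s +ᶠ t Fin.≟ 0ᶠ
        ... | yes _ | _     = A₀
        ... | no _  | yes _ = Aₛ
        ... | no _  | no _  = A₁

        -- The values 0 and -s are distinct because s ≠ 0; the other p - 2 values give A₁.
        ∑-G : ∀ {s} → s ≢ 0ᶠ → ∑ (allFin p) (G s) ≡ A₀ + Aₛ + (p ∸ 2) * A₁
        ∑-G {s} s≢0 = begin
          ∑ (allFin p) (G s)                             ≡⟨ m+n∸n≡m _ (A₁ + A₁) ⟨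
          ∑ (allFin p) (G s) + (A₁ + A₁) ∸ (A₁ + A₁)         ≡⟨ cong (_∸ (A₁ + A₁)) padded ⟩
          A₀ + Aₛ + p * A₁ ∸ (A₁ + A₁)                        ≡⟨ cong (λ k → A₀ + Aₛ + p * A₁ ∸ k) (cong (A₁ +_) (+-identityʳ A₁)) ⟨
          A₀ + Aₛ + p * A₁ ∸ 2 * A₁                          ≡⟨ +-∸-assoc (A₀ + Aₛ) (*-monoˡ-≤ A₁ (nonTrivial⇒n>1 p {{prime⇒nonTrivial isPrime}})) ⟩
          A₀ + Aₛ + (p * A₁ ∸ 2 * A₁)                        ≡⟨ cong (A₀ + Aₛ +_) (*-distribʳ-∸ A₁ p 2) ⟨
          A₀ + Aₛ + (p ∸ 2) * A₁                            ∎
          where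
          open ≡-Reasoning
          point : 𝔽 p → ℕ → 𝔽 p → ℕ
          point c k t = 𝟙 (t Fin.≟ c) * k
          ∑-point : ∀ c k → ∑ (allFin p) (point c k) ≡ k
          ∑-point c k = ∑-single Fin._≟_ allFin-enumerates (λ _ → k) c
          0≢-s : 0ᶠ ≢ -ᶠ s
          0≢-s eq = s≢0 (trans (sym (+ᶠ-identityʳ s)) (trans (cong (s +ᶠ_) eq) (+ᶠ-inverseʳ s)))
          rearrange₁ : ∀ a c → a + (1 * c + 0) ≡ 1 * a + 0 + c
          rearrange₁ = solve-∀
          rearrange₂ : ∀ b c → b + (0 + 1 * c) ≡ 0 + 1 * b + c
          rearrange₂ = solve-∀
          pointwise : ∀ t → G s t + (point 0ᶠ A₁ t + point (-ᶠ s) A₁ t) ≡ (point 0ᶠ A₀ t + point (-ᶠ s) Aₛ t) + A₁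
          pointwise t with t Fin.≟ 0ᶠ | s +ᶠ t Fin.≟ 0ᶠ
          ... | yes refl | _ rewrite 𝟙-no (0ᶠ Fin.≟ -ᶠ s) (0≢-s) = rearrange₁ A₀ A₁
          ... | no t≢0 | yes s+t≡0 rewrite 𝟙-yes (t Fin.≟ -ᶠ s) (-ᶠ-uniqueʳ s t s+t≡0) = rearrange₂ Aₛ A₁
          ... | no t≢0 | no s+t≢0
            rewrite 𝟙-no (t Fin.≟ -ᶠ s) (λ t≡-s → s+t≢0 (trans (cong (s +ᶠ_) t≡-s) (+ᶠ-inverseʳ s))) = +-identityʳ A₁
          padded : ∑ (allFin p) (G s) + (A₁ + A₁) ≡ A₀ + Aₛ + p * A₁
          padded = begin
            ∑ (allFin p) (G s) + (A₁ + A₁)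
              ≡⟨ cong (∑ (allFin p) (G s) +_) (cong₂ _+_ (∑-point 0ᶠ A₁) (∑-point (-ᶠ s) A₁)) ⟨
            ∑ (allFin p) (G s) + (∑ (allFin p) (point 0ᶠ A₁) + ∑ (allFin p) (point (-ᶠ s) A₁))
              ≡⟨ cong (∑ (allFin p) (G s) +_) (∑-+ (allFin p) (point 0ᶠ A₁) (point (-ᶠ s) A₁)) ⟨
            ∑ (allFin p) (G s) + ∑ (allFin p) (λ t → point 0ᶠ A₁ t + point (-ᶠ s) A₁ t)
              ≡⟨ ∑-+ (allFin p) (G s) _ ⟨
            ∑ (allFin p) (λ t → G s t + (point 0ᶠ A₁ t + point (-ᶠ s) A₁ t))
              ≡⟨ ∑-cong (allFin p) pointwise ⟩
            ∑ (allFin p) (λ t → (point 0ᶠ A₀ t + point (-ᶠ s) Aₛ t) + A₁)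
              ≡⟨ ∑-+ (allFin p) (λ t → point 0ᶠ A₀ t + point (-ᶠ s) Aₛ t) (λ _ → A₁) ⟩
            ∑ (allFin p) (λ t → point 0ᶠ A₀ t + point (-ᶠ s) Aₛ t) + ∑ (allFin p) (λ _ → A₁)
              ≡⟨ cong₂ _+_ (∑-+ (allFin p) (point 0ᶠ A₀) (point (-ᶠ s) Aₛ)) (∑-const (allFin p) A₁) ⟩
            ∑ (allFin p) (point 0ᶠ A₀) + ∑ (allFin p) (point (-ᶠ s) Aₛ) + length (allFin p) * A₁
              ≡⟨ cong₂ _+_ (cong₂ _+_ (∑-point 0ᶠ A₀) (∑-point (-ᶠ s) Aₛ)) (cong (_* A₁) length-allFin) ⟩
            A₀ + Aₛ + p * A₁ ∎

        1≤p^ : ∀ k → 1 ≤ p ^ k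
        1≤p^ k = >-nonZero⁻¹ (p ^ k) {{m^n≢0 p k}}

        module _ {s : 𝔽 p} (s≢0 : s ≢ 0ᶠ) where

          open ≡-Reasoning

          -- The sum of h over all w, for fixed s and v.
          fibre : Vec (𝔽 p) m → ℕ
          fibre v = ∑ (allVecs p r) (λ w → h (wt (codeword f s (v ++ w))))

          fibre-constant-off : ∀ v k → (∀ w → w ≢ 0ʳ → h (wt (codeword f s (v ++ w))) ≡ k) →
            fibre v ≡ h (wt (codeword f s (v ++ 0ʳ))) + R₁ * k
          fibre-constant-off v k const = trans
            (∑-constant-off _≟ⱽ_ (allVecs-enumerates r) (λ w → h (wt (codeword f s (v ++ w)))) 0ʳ k const)
            (cong (λ l → h (wt (codeword f s (v ++ 0ʳ))) + (l ∸ 1) * k) (length-allVecs r))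

          fibre-0 : fibre 0ᵐ ≡ D₀
          fibre-0 = trans (fibre-constant-off 0ᵐ _ (λ w w≢0 → cong h (wt-v≡0 s≢0 w≢0)))
            (cong (λ k → h k + R₁ * h (Q + p ^ m ∸ 2)) (wt-f s≢0))

          fibre-≢0 : ∀ {v} → v ≢ 0ᵐ → fibre v ≡ G s (τ v)
          fibre-≢0 {v} v≢0 with τ v Fin.≟ 0ᶠ | s +ᶠ τ v Fin.≟ 0ᶠ
          ... | yes τ≡0 | _ = trans
            (fibre-constant-off v _ (λ w w≢0 → cong h (wt-w≢0-τ≡0 s≢0 v≢0 w≢0 τ≡0)))
            (cong (λ k → h k + R₁ * h (Q ∸ 2)) (wt-w≡0-τ≡0 s≢0 v≢0 τ≡0))
          ... | no _ | yes eq = trans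
            (fibre-constant-off v _ (λ w w≢0 → cong h (wt-w≢0-s+τ≡0 s≢0 v≢0 w≢0 eq)))
            (cong (λ k → h k + R₁ * h Q) (wt-w≡0-s+τ≡0 s≢0 v≢0 eq))
          ... | no τ≢ | no s+τ≢ = trans
            (fibre-constant-off v _ (λ w w≢0 → cong h (wt-w≢0-generic s≢0 v≢0 w≢0 τ≢ s+τ≢)))
            (cong (λ k → h k + R₁ * h (Q ∸ 1)) (wt-w≡0-generic s≢0 v≢0 τ≢ s+τ≢))

          -- The sum over v ≠ 0. Adding the missing term A₀ at v = 0 makes τ equidistributed.
          off-sum : ℕ
          off-sum = ∑ (allVecs p m) (λ v → 𝟙 (nonzero? v) * G s (τ v))

          G-zero : ∀ t → t ≡ 0ᶠ → G s t ≡ A₀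
          G-zero t t≡0 with t Fin.≟ 0ᶠ | s +ᶠ t Fin.≟ 0ᶠ
          ... | yes _  | _ = refl
          ... | no t≢0 | _ = ⊥-elim (t≢0 t≡0)

          off-sum-value : off-sum ≡ (p ^ m′ ∸ 1) * A₀ + p ^ m′ * (Aₛ + (p ∸ 2) * A₁)
          off-sum-value = +-cancelˡ-≡ A₀ _ _ (begin
            A₀ + off-sum
              ≡⟨ cong (_+ off-sum) (G-zero (τ 0ᵐ) (∙-zeroˡ (minusOnes m))) ⟨
            G s (τ 0ᵐ) + off-sum
              ≡⟨ ∑-split _≟ⱽ_ (allVecs-enumerates m) (λ v → G s (τ v)) 0ᵐ ⟨
            ∑ (allVecs p m) (λ v → G s (τ v))
              ≡⟨ ∑-cong (allVecs p m) (λ v → cong (G s) (∙-comm v (minusOnes m))) ⟩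
            ∑ (allVecs p m) (λ v → G s (minusOnes m ∙ v))
              ≡⟨ equidistribution isPrime (minusOnes m) (minusOnes≢0 isPrime m′) (G s) ⟩
            p ^ m′ * ∑ (allFin p) (G s)
              ≡⟨ cong₂ _*_ (sym (m+[n∸m]≡n (1≤p^ m′))) (∑-G s≢0) ⟩
            (1 + (p ^ m′ ∸ 1)) * (A₀ + Aₛ + (p ∸ 2) * A₁)
              ≡⟨ expand (p ^ m′ ∸ 1) A₀ Aₛ ((p ∸ 2) * A₁) ⟩
            A₀ + ((p ^ m′ ∸ 1) * A₀ + (1 + (p ^ m′ ∸ 1)) * (Aₛ + (p ∸ 2) * A₁))
              ≡⟨ cong (λ k → A₀ + ((p ^ m′ ∸ 1) * A₀ + k * (Aₛ + (p ∸ 2) * A₁))) (m+[n∸m]≡n (1≤p^ m′)) ⟩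
            A₀ + ((p ^ m′ ∸ 1) * A₀ + p ^ m′ * (Aₛ + (p ∸ 2) * A₁)) ∎)
            where
            expand : ∀ M₁ a b c → (1 + M₁) * (a + b + c) ≡ a + (M₁ * a + (1 + M₁) * (b + c))
            expand = solve-∀

          ∑-s≢0 : ∑ (allVecs p (m + r)) (λ u → h (wt (codeword f s u))) ≡
                  D₀ + ((p ^ m′ ∸ 1) * A₀ + p ^ m′ * (Aₛ + (p ∸ 2) * A₁))
          ∑-s≢0 = begin
            ∑ (allVecs p (m + r)) (λ u → h (wt (codeword f s u)))
              ≡⟨ ∑-++-split m r _ ⟩
            ∑ (allVecs p m) fibre
              ≡⟨ ∑-split _≟ⱽ_ (allVecs-enumerates m) fibre 0ᵐ ⟩
            fibre 0ᵐ + ∑ (allVecs p m) (λ v → 𝟙 (nonzero? v) * fibre v)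
              ≡⟨ cong₂ _+_ fibre-0 (∑-cong (allVecs p m) replace) ⟩
            D₀ + off-sum
              ≡⟨ cong (D₀ +_) off-sum-value ⟩
            D₀ + ((p ^ m′ ∸ 1) * A₀ + p ^ m′ * (Aₛ + (p ∸ 2) * A₁)) ∎
            where
            replace : ∀ v → 𝟙 (nonzero? v) * fibre v ≡ 𝟙 (nonzero? v) * G s (τ v)
            replace v with v ≟ⱽ 0ᵐ
            ... | yes _  = refl
            ... | no v≢0 = cong (_+ 0) (fibre-≢0 v≢0)

        ∑-s≡0 : ∑ (allVecs p (m + r)) (λ u → 𝟙 (nonzero? (0ᶠ ∷ u)) * h (wt (codeword f 0ᶠ u))) ≡
                (p ^ (m + r) ∸ 1) * h Q
        ∑-s≡0 = begin
          ∑ (allVecs p (m + r)) term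
            ≡⟨ ∑-constant-off _≟ⱽ_ (allVecs-enumerates (m + r)) term 0ᵛ (h Q) off-zero ⟩
          term 0ᵛ + (length (allVecs p (m + r)) ∸ 1) * h Q
            ≡⟨ cong₂ (λ a l → a * h (wt (codeword f 0ᶠ 0ᵛ)) + (l ∸ 1) * h Q)
                 (𝟙-no (nonzero? {n = suc (m + r)} (0ᶠ ∷ 0ᵛ)) (λ e → e refl)) (length-allVecs (m + r)) ⟩
          (p ^ (m + r) ∸ 1) * h Q ∎
          where
          open ≡-Reasoning
          term : Vec (𝔽 p) (m + r) → ℕ
          term u = 𝟙 (nonzero? (0ᶠ ∷ u)) * h (wt (codeword f 0ᶠ u))
          off-zero : ∀ u → u ≢ 0ᵛ → term u ≡ h Q
          off-zero u u≢0 = trans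
            (cong₂ _*_ (𝟙-yes (nonzero? (0ᶠ ∷ u)) (λ eq → u≢0 (proj₂ (∷-injective eq)))) (cong h (wt-linear′ u u≢0)))
            (*-identityˡ (h Q))

      -- For every h, the sum of h over the weights of the nonzero messages.
      weight-sum : ∑ (allVecs p (suc (m + r))) (λ a → 𝟙 (nonzero? a) * h (wt (encode f a))) ≡
                   ∑ rows (λ row → proj₂ row * h (proj₁ row))
      weight-sum = begin
        ∑ (allVecs p (suc (m + r))) (λ a → 𝟙 (nonzero? a) * h (wt (encode f a)))
          ≡⟨ ∑-cartesianProductWith _∷_ (allFin p) _ _ ⟩
        ∑ (allFin p) slice
          ≡⟨ ∑-constant-off Fin._≟_ allFin-enumerates slice 0ᶠ K slice-≢0 ⟩
        slice 0ᶠ + (length (allFin p) ∸ 1) * K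
          ≡⟨ cong₂ (λ a l → a + (l ∸ 1) * K) ∑-s≡0 length-allFin ⟩
        (p ^ (m + r) ∸ 1) * h Q + (p ∸ 1) * K
          ≡⟨ collect (p ∸ 1) (p ∸ 2) (p ^ m′) (p ^ m′ ∸ 1) R₁ (p ^ (m + r) ∸ 1)
               (h (p ^ m + p ^ r ∸ 2)) (h (Q ∸ p ^ r)) (h (Q ∸ 2)) (h (Q ∸ 1)) (h Q)
               (h (Q + p ^ m ∸ 2)) (h (Q + p ^ r ∸ 2)) ⟩
        total (p ^ m′ * (1 + R₁))
          ≡⟨ cong total (trans (cong (p ^ m′ *_) (m+[n∸m]≡n (1≤p^ r))) (sym (^-distribˡ-+-* p m′ r))) ⟩
        ∑ rows (λ row → proj₂ row * h (proj₁ row)) ∎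
        where
        open ≡-Reasoning
        slice : 𝔽 p → ℕ
        slice s = ∑ (allVecs p (m + r)) (λ u → 𝟙 (nonzero? (s ∷ u)) * h (wt (codeword f s u)))
        K : ℕ
        K = D₀ + ((p ^ m′ ∸ 1) * A₀ + p ^ m′ * (Aₛ + (p ∸ 2) * A₁))
        slice-≢0 : ∀ s → s ≢ 0ᶠ → slice s ≡ K
        slice-≢0 s s≢0 = trans (∑-cong (allVecs p (m + r)) (λ u →
            trans (cong (_* h (wt (codeword f s u))) (𝟙-yes (nonzero? (s ∷ u)) (λ eq → s≢0 (proj₁ (∷-injective eq)))))
                  (*-identityˡ _)))
          (∑-s≢0 s≢0)
        total : ℕ → ℕ
        total pⁿ⁻¹ =
          (p ∸ 1) * h (p ^ m + p ^ r ∸ 2) + ((p ∸ 1) * p ^ m′ * h (Q ∸ p ^ r) +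
          ((p ∸ 1) * (p ^ m′ ∸ 1) * R₁ * h (Q ∸ 2) + ((p ∸ 1) * (p ∸ 2) * pⁿ⁻¹ * h (Q ∸ 1) +
          (((p ^ (m + r) ∸ 1) + (p ∸ 1) * p ^ m′ * R₁) * h Q + ((p ∸ 1) * R₁ * h (Q + p ^ m ∸ 2) +
          ((p ∸ 1) * (p ^ m′ ∸ 1) * h (Q + p ^ r ∸ 2) + 0))))))
        collect : ∀ k k₂ M M₁ R N h₁ h₂ h₃ h₄ h₅ h₆ h₇ →
          N * h₅ + k * ((h₁ + R * h₆) + (M₁ * (h₇ + R * h₃) + M * ((h₂ + R * h₅) + k₂ * (h₄ + R * h₄)))) ≡
          k * h₁ + (k * M * h₂ + (k * M₁ * R * h₃ + (k * k₂ * (M * (1 + R)) * h₄ +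
          ((N + k * M * R) * h₅ + (k * R * h₆ + (k * M₁ * h₇ + 0))))))
        collect = solve-∀

  -- Minimality

  module Minimality (isPrime : Prime p) (2<p : 2 < p) {m″ r″ : ℕ}
    {f : Vec (𝔽 p) (suc (suc m″) + suc (suc r″)) → 𝔽 p}
    (ind : IsIdealIndicator (suc (suc m″)) (suc (suc r″)) f) where

    open IsIdealIndicator ind

    private
      m r : ℕ
      m = suc (suc m″)
      r = suc (suc r″)

      0ᵐ : Vec (𝔽 p) m
      0ᵐ = 0ᵛ

      0ʳ : Vec (𝔽 p) r
      0ʳ = 0ᵛ

      -1ᵐ : Vec (𝔽 p) m
      -1ᵐ = minusOnes m

    -- With a = -1 the equation -a = a gives 1 + 1 = (a + 1) + (a + 1) = 0, impossible for p > 2.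
    negated-minusOnes : (-ᶠ 1ᶠ) *ᵛ -1ᵐ ≢ -1ᵐ
    negated-minusOnes eq = []≢[] 2<p (<-trans (s≤s z≤n) 2<p) (λ ()) (begin
      [ 2 ]ᶠ                       ≡⟨ []-+ 1 1 ⟨
      1ᶠ +ᶠ 1ᶠ                     ≡⟨ +ᶠ-identityˡ _ ⟨
      0ᶠ +ᶠ (1ᶠ +ᶠ 1ᶠ)             ≡⟨ cong (_+ᶠ (1ᶠ +ᶠ 1ᶠ)) a+a≡0 ⟨
      a +ᶠ a +ᶠ (1ᶠ +ᶠ 1ᶠ)         ≡⟨ +ᶠ-interchange a a 1ᶠ 1ᶠ ⟩
      a +ᶠ 1ᶠ +ᶠ (a +ᶠ 1ᶠ)         ≡⟨ cong₂ _+ᶠ_ a+1≡0 a+1≡0 ⟩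
      0ᶠ +ᶠ 0ᶠ                     ≡⟨ +ᶠ-identityˡ 0ᶠ ⟩
      0ᶠ                           ∎)
      where
      open ≡-Reasoning
      a : 𝔽 p
      a = [ p ∸ 1 ]ᶠ
      a+1≡0 : a +ᶠ 1ᶠ ≡ 0ᶠ
      a+1≡0 = begin
        a +ᶠ 1ᶠ            ≡⟨ []-+ (p ∸ 1) 1 ⟩
        [ p ∸ 1 + 1 ]ᶠ     ≡⟨ cong [_]ᶠ (m∸n+n≡m (<⇒≤ (<-trans (s≤s (s≤s z≤n)) 2<p))) ⟩
        [ p ]ᶠ             ≡⟨ [p] ⟩
        0ᶠ                 ∎
      a+a≡0 : a +ᶠ a ≡ 0ᶠ
      a+a≡0 = begin
        a +ᶠ a                  ≡⟨ cong (a +ᶠ_) (proj₁ (∷-injective eq)) ⟨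
        a +ᶠ (-ᶠ 1ᶠ) *ᶠ a       ≡⟨ cong (a +ᶠ_) (-ᶠ-distribˡ-* 1ᶠ a) ⟨
        a +ᶠ -ᶠ (1ᶠ *ᶠ a)       ≡⟨ cong (λ b → a +ᶠ -ᶠ b) (*ᶠ-identityˡ a) ⟩
        a +ᶠ -ᶠ a               ≡⟨ +ᶠ-inverseʳ a ⟩
        0ᶠ                      ∎

    module _ {s s′ : 𝔽 p} {v v′ : Vec (𝔽 p) m} {w w′ : Vec (𝔽 p) r} where

      private
        u u′ : Vec (𝔽 p) (m + r)
        u  = v ++ w
        u′ = v′ ++ w′

      module _ (zeros : ∀ x → s *ᶠ f x +ᶠ u ∙ x ≡ 0ᶠ → s′ *ᶠ f x +ᶠ u′ ∙ x ≡ 0ᶠ) where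

        -- Off S the entries of the codewords are the values of the linear forms.
        zeros-off : ∀ x → f x ≡ 0ᶠ → u ∙ x ≡ 0ᶠ → u′ ∙ x ≡ 0ᶠ
        zeros-off x fx≡0 ux≡0 = trans (sym (drop-f s′ u′)) (zeros x (trans (drop-f s u) ux≡0))
          where
          drop-f : ∀ t y → t *ᶠ f x +ᶠ y ∙ x ≡ y ∙ x
          drop-f t y = trans (cong (_+ᶠ y ∙ x) (trans (cong (t *ᶠ_) fx≡0) (*ᶠ-zeroʳ t))) (+ᶠ-identityˡ _)

        -- If x ++ y lies in S then x is (-1,…,-1), so its negative is outside S.
        kernel-right : ∀ x y → y ≢ 0ʳ → u ∙ (x ++ y) ≡ 0ᶠ → u′ ∙ (x ++ y) ≡ 0ᶠ
        kernel-right x y y≢0 ux≡0 with x ≟ⱽ -1ᵐ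
        ... | no x≢-1 = zeros-off (x ++ y) (off y≢0 x≢-1) ux≡0
        ... | yes refl = *ᶠ-cancel-zero isPrime -1≢0 (trans (sym (∙-*ʳ u′ (-ᶠ 1ᶠ) (x ++ y))) (zeros-off ((-ᶠ 1ᶠ) *ᵛ (x ++ y))
            (trans (cong f (*ᵛ-++ (-ᶠ 1ᶠ) x y)) (off -y≢0 negated-minusOnes))
            (trans (∙-*ʳ u (-ᶠ 1ᶠ) (x ++ y)) (trans (cong ((-ᶠ 1ᶠ) *ᶠ_) ux≡0) (*ᶠ-zeroʳ (-ᶠ 1ᶠ))))))
          where
          -1≢0 : -ᶠ 1ᶠ ≢ 0ᶠ
          -1≢0 eq = 1≢0 isPrime (trans (sym (-ᶠ-involutive 1ᶠ)) (trans (cong -ᶠ_ eq) -ᶠ-zero))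
          -y≢0 : (-ᶠ 1ᶠ) *ᵛ y ≢ 0ʳ
          -y≢0 eq = y≢0 (sym (vec-difference 0ᵛ y (trans (+ᵛ-identityˡ _) eq)))

        -- A point x₁ ++ 0 is the difference of x₁ ++ y and 0 ++ y, where y ≠ 0 and w ∙ y = 0.
        kernel : ∀ x → u ∙ x ≡ 0ᶠ → u′ ∙ x ≡ 0ᶠ
        kernel x ux≡0 with Vec.splitAt m x
        ... | x₁ , x₂ , refl with x₂ ≟ⱽ 0ʳ
        ...   | no x₂≢0 = kernel-right x₁ x₂ x₂≢0 ux≡0
        ...   | yes refl with y , y≢0 , wy≡0 ← ∙-kernel isPrime w = begin
          u′ ∙ (x₁ ++ 0ʳ)                         ≡⟨ +ᶠ-identityʳ _ ⟨
          u′ ∙ (x₁ ++ 0ʳ) +ᶠ 0ᶠ                   ≡⟨ cong (u′ ∙ (x₁ ++ 0ʳ) +ᶠ_) (kernel-right 0ᵐ y y≢0 uy≡0) ⟨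
          u′ ∙ (x₁ ++ 0ʳ) +ᶠ u′ ∙ (0ᵐ ++ y)       ≡⟨ ∙-+ʳ u′ (x₁ ++ 0ʳ) (0ᵐ ++ y) ⟨
          u′ ∙ ((x₁ ++ 0ʳ) +ᵛ (0ᵐ ++ y))          ≡⟨ cong (u′ ∙_) sum-eq ⟩
          u′ ∙ (x₁ ++ y)                          ≡⟨ kernel-right x₁ y y≢0 ux₁y≡0 ⟩
          0ᶠ                                      ∎
          where
          open ≡-Reasoning
          sum-eq : (x₁ ++ 0ʳ) +ᵛ (0ᵐ ++ y) ≡ x₁ ++ y
          sum-eq = trans (+ᵛ-++ x₁ 0ᵐ 0ʳ y) (cong₂ _++_ (+ᵛ-identityʳ x₁) (+ᵛ-identityˡ y))
          uy≡0 : u ∙ (0ᵐ ++ y) ≡ 0ᶠ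
          uy≡0 = trans (∙-++ v 0ᵐ w y) (trans (cong₂ _+ᶠ_ (∙-zeroʳ v) wy≡0) (+ᶠ-identityˡ 0ᶠ))
          ux₁y≡0 : u ∙ (x₁ ++ y) ≡ 0ᶠ
          ux₁y≡0 = trans (cong (u ∙_) (sym sum-eq)) (trans (∙-+ʳ u (x₁ ++ 0ʳ) (0ᵐ ++ y))
            (trans (cong₂ _+ᶠ_ ux≡0 uy≡0) (+ᶠ-identityˡ 0ᶠ)))

      -- A nonzero linear form takes every value on S.
      ideal-solution : (v ≢ 0ᵐ ⊎ w ≢ 0ʳ) → ∀ t → ∃ λ x → f x ≡ 1ᶠ × (v ++ w) ∙ x ≡ t
      ideal-solution vw≢0 t with v ≟ⱽ 0ᵐ | vw≢0
      ... | no v≢0   | _ with x , x≢0 , eq ← ∙-solution isPrime v t (inj₁ v≢0) =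
        x ++ 0ʳ , on-left x≢0 , trans (∙-++ v x w 0ʳ) (trans (cong₂ _+ᶠ_ eq (∙-zeroʳ w)) (+ᶠ-identityʳ t))
      ... | yes v≡0  | inj₁ v≢0 = ⊥-elim (v≢0 v≡0)
      ... | yes refl | inj₂ w≢0 with y , y≢0 , eq ← ∙-solution isPrime w t (inj₁ w≢0) =
        -1ᵐ ++ y , on-right y≢0 , trans (∙-++ 0ᵐ -1ᵐ w y) (trans (cong₂ _+ᶠ_ (∙-zeroˡ -1ᵐ) eq) (+ᶠ-identityˡ t))

    -- A message whose codeword vanishes wherever that of a does is a multiple of a.
    message-multiple : ∀ s u s′ u′ → s ∷ u ≢ 0ᵛ →
      (∀ x → s *ᶠ f x +ᶠ u ∙ x ≡ 0ᶠ → s′ *ᶠ f x +ᶠ u′ ∙ x ≡ 0ᶠ) →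
      ∃ λ a → s′ ∷ u′ ≡ a *ᵛ (s ∷ u)
    message-multiple s u s′ u′ su≢0 zeros
      with v , w , refl ← Vec.splitAt m u | v′ , w′ , refl ← Vec.splitAt m u′
      with a , u′≡au ← kernel-inclusion isPrime (v ++ w) (v′ ++ w′) (kernel {s} {s′} {v} {v′} {w} {w′} zeros)
      = by-cases (v ≟ⱽ 0ᵐ) (w ≟ⱽ 0ʳ)
      where
      open ≡-Reasoning
      Goal : Set
      Goal = ∃ λ b → s′ ∷ (v′ ++ w′) ≡ b *ᵛ (s ∷ (v ++ w))
      by-point : (v ≢ 0ᵐ ⊎ w ≢ 0ʳ) → Goal
      by-point vw≢0 with x , fx≡1 , ux≡-s ← ideal-solution {s} {s′} {v} {v′} {w} {w′} vw≢0 (-ᶠ s) =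
        a , cong₂ _∷_ s′≡as u′≡au
        where
        at-x : s *ᶠ f x +ᶠ (v ++ w) ∙ x ≡ 0ᶠ
        at-x = trans (cong₂ _+ᶠ_ (trans (cong (s *ᶠ_) fx≡1) (*ᶠ-identityʳ s)) ux≡-s) (+ᶠ-inverseʳ s)
        s′≡as : s′ ≡ a *ᶠ s
        s′≡as = begin
          s′                            ≡⟨ -ᶠ-uniqueˡ s′ (a *ᶠ (-ᶠ s)) (begin
            s′ +ᶠ a *ᶠ (-ᶠ s)                     ≡⟨ cong₂ _+ᶠ_ (trans (cong (s′ *ᶠ_) fx≡1) (*ᶠ-identityʳ s′)) (cong (a *ᶠ_) ux≡-s) ⟨
            s′ *ᶠ f x +ᶠ a *ᶠ ((v ++ w) ∙ x)      ≡⟨ cong (s′ *ᶠ f x +ᶠ_) (∙-*ˡ a (v ++ w) x) ⟨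
            s′ *ᶠ f x +ᶠ (a *ᵛ (v ++ w)) ∙ x      ≡⟨ cong (λ y → s′ *ᶠ f x +ᶠ y ∙ x) u′≡au ⟨
            s′ *ᶠ f x +ᶠ (v′ ++ w′) ∙ x           ≡⟨ zeros x at-x ⟩
            0ᶠ                                    ∎) ⟩
          -ᶠ (a *ᶠ (-ᶠ s))              ≡⟨ cong -ᶠ_ (-ᶠ-distribʳ-* a s) ⟨
          -ᶠ (-ᶠ (a *ᶠ s))              ≡⟨ -ᶠ-involutive _ ⟩
          a *ᶠ s                        ∎
      by-cases : Dec (v ≡ 0ᵐ) → Dec (w ≡ 0ʳ) → Goal
      by-cases (no v≢0)   _          = by-point (inj₁ v≢0)
      by-cases (yes _)    (no w≢0)   = by-point (inj₂ w≢0)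
      by-cases (yes refl) (yes refl) = s′ *ᶠ c , cong₂ _∷_ s′≡s′cs (trans u′≡au (trans (times-0 a) (sym (times-0 (s′ *ᶠ c)))))
        where
        s≢0 : s ≢ 0ᶠ
        s≢0 s≡0 = su≢0 (cong₂ _∷_ s≡0 (++-zero m r))
        c : 𝔽 p
        c = proj₁ (inverse isPrime s s≢0)
        s′≡s′cs : s′ ≡ (s′ *ᶠ c) *ᶠ s
        s′≡s′cs = begin
          s′                   ≡⟨ *ᶠ-identityʳ s′ ⟨
          s′ *ᶠ 1ᶠ             ≡⟨ cong (s′ *ᶠ_) (trans (sym (proj₂ (inverse isPrime s s≢0))) (*ᶠ-comm s c)) ⟩
          s′ *ᶠ (c *ᶠ s)       ≡⟨ *ᶠ-assoc s′ c s ⟨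
          (s′ *ᶠ c) *ᶠ s       ∎
        times-0 : ∀ b → b *ᵛ (0ᵐ ++ 0ʳ) ≡ 0ᵛ
        times-0 b = trans (cong (b *ᵛ_) (++-zero m r)) (*ᵛ-zeroʳ b)

    𝒞-minimal : IsMinimal (𝒞 f)
    𝒞-minimal {c} c∈𝒞@(s , u , refl) c≢0 = record
      { codeword = c∈𝒞
      ; nonzero  = c≢0
      ; minimal  = λ { (s′ , u′ , refl) sub → multiple s′ u′ sub } }
      where
      open IsLinearMap (encode-linear f)
      multiple : ∀ s′ u′ → supp (codeword f s′ u′) ⊆ₛ supp (codeword f s u) →
        ∃ λ a → codeword f s′ u′ ≡ a *ᵛ codeword f s u
      multiple s′ u′ sub = proj₁ scalar , trans (cong (encode f) (proj₂ scalar)) (L-* (proj₁ scalar) (s ∷ u))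
        where
        zero-entry : ∀ t y → t *ᶠ f 0ᵛ +ᶠ y ∙ 0ᵛ ≡ 0ᶠ
        zero-entry t y = trans (cong₂ _+ᶠ_ (trans (cong (t *ᶠ_) at-zero) (*ᶠ-zeroʳ t)) (∙-zeroʳ y)) (+ᶠ-identityˡ 0ᶠ)
        zeros : ∀ x → s *ᶠ f x +ᶠ u ∙ x ≡ 0ᶠ → s′ *ᶠ f x +ᶠ u′ ∙ x ≡ 0ᶠ
        zeros x eq with x ≟ⱽ 0ᵛ
        ... | yes refl = zero-entry s′ u′
        ... | no x≢0   = zeros-included f {s} {u} {s′} {u′} sub x x≢0 eq
        scalar : ∃ λ a → s′ ∷ u′ ≡ a *ᵛ (s ∷ u)
        scalar = message-multiple s u s′ u′ (λ su≡0 → c≢0 (trans (cong (encode f) su≡0) L-0)) zeros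

  -- The saturated ideals contained in the full multiset

  χ-in : ∀ {k} {P : Vec (𝔽 p) k → Set} (P? : ∀ x → Dec (P x)) {x} → P x → χ P? x ≡ 1ᶠ
  χ-in P? {x} px with P? x
  ... | yes _  = refl
  ... | no ¬px = ⊥-elim (¬px px)

  χ-out : ∀ {k} {P : Vec (𝔽 p) k → Set} (P? : ∀ x → Dec (P x)) {x} → ¬ P x → χ P? x ≡ 0ᶠ
  χ-out P? {x} ¬px with P? x
  ... | yes px = ⊥-elim (¬px px)
  ... | no _   = refl

  ∈-supp⁺ : ∀ {k} (x : Vec (𝔽 p) k) i → lookup x i ≢ 0ᶠ → i ∈ₛ supp x
  ∈-supp⁺ x i xi≢0 = lookup⇒[]= i (supp x) (trans (lookup-map i _ x) (nonzero-entry (lookup x i) xi≢0))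
    where
    nonzero-entry : ∀ (a : 𝔽 p) → a ≢ 0ᶠ → not (does (a Fin.≟ 0ᶠ)) ≡ true
    nonzero-entry a a≢0 with a Fin.≟ 0ᶠ
    ... | yes a≡0 = ⊥-elim (a≢0 a≡0)
    ... | no _    = refl

  ∈-supp⁻ : ∀ {k} (x : Vec (𝔽 p) k) i → i ∈ₛ supp x → lookup x i ≢ 0ᶠ
  ∈-supp⁻ x i i∈ xi≡0 = zero-entry (lookup x i) xi≡0 (trans (sym (lookup-map i _ x)) ([]=⇒lookup i∈))
    where
    zero-entry : ∀ (a : 𝔽 p) → a ≡ 0ᶠ → not (does (a Fin.≟ 0ᶠ)) ≢ true
    zero-entry a a≡0 with a Fin.≟ 0ᶠ
    ... | yes _  = λ ()
    ... | no a≢0 = ⊥-elim (a≢0 a≡0)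

  lookup-constant : ∀ {k} (x : Vec (𝔽 p) k) c → (∀ i → lookup x i ≡ c) → x ≡ replicate k c
  lookup-constant []      c eq = refl
  lookup-constant (a ∷ x) c eq = cong₂ _∷_ (eq Fin.zero) (lookup-constant x c (λ i → eq (Fin.suc i)))

  nonzero-coordinate : ∀ {k} (x : Vec (𝔽 p) k) → x ≢ 0ᵛ → ∃ λ i → lookup x i ≢ 0ᶠ
  nonzero-coordinate {k} x x≢0 = Fin.¬∀⟶∃¬ k (λ i → lookup x i ≡ 0ᶠ) (λ i → lookup x i Fin.≟ 0ᶠ)
    (λ all → x≢0 (lookup-constant x 0ᶠ all))

  toℕ-[p∸1] : toℕ {p} [ p ∸ 1 ]ᶠ ≡ p ∸ 1
  toℕ-[p∸1] = trans (toℕ-[] (p ∸ 1)) (m<n⇒m%n≡m (≤-reflexive (suc-pred p)))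

  -- The function f of the statement for n = m + r.
  idealIndicator : ∀ m r → Vec (𝔽 p) (m + r) → 𝔽 p
  idealIndicator m r = χ (λ x → saturatedIdealsIn? (hierarchical? m (m + r)) (fullMultiset p (m + r)) x ×-dec nonzero? x)

  idealIndicator-isIdealIndicator : Prime p → ∀ m r → IsIdealIndicator m r (idealIndicator m r)
  idealIndicator-isIdealIndicator pr m r = record
    { at-zero  = χ-out member? {0ᵛ} (λ { (_ , 0≢0) → 0≢0 refl })
    ; on-left  = λ {v} v≢0 → χ-in member? ((saturated-left v , below (v ++ 0ᵛ)) , λ eq → v≢0 (proj₁ (++-zero⁻ v eq)))
    ; on-right = λ {w} w≢0 → χ-in member? ((saturated-right w , below (minusOnes m ++ w)) ,
                   λ eq → w≢0 (proj₂ (++-zero⁻ (minusOnes m) eq)))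
    ; off      = λ {v} {w} w≢0 v≢-1 → χ-out member? (λ { (((_ , full) , _) , _) → not-saturated v w w≢0 v≢-1 full }) }
    where
    n : ℕ
    n = m + r

    member? : ∀ x → Dec (SaturatedIdealsIn (Hierarchical m n) (fullMultiset p n) x × Nonzero x)
    member? x = saturatedIdealsIn? (hierarchical? m n) (fullMultiset p n) x ×-dec nonzero? x

    below : ∀ x → x ⊆ᵐ fullMultiset p n
    below x i = subst (toℕ (lookup x i) ≤_)
      (sym (trans (cong toℕ (lookup-replicate i [ p ∸ 1 ]ᶠ)) toℕ-[p∸1]))
      (<⇒≤pred (Fin.toℕ<n (lookup x i)))

    saturated-left : ∀ v → IsSaturatedIdeal (Hierarchical m n) (v ++ 0ᵛ {n = r})
    saturated-left v = (λ j i j∈ i≺j → ⊥-elim (outside j (proj₂ i≺j) j∈)) ,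
                       (λ j i j∈ i≺j → ⊥-elim (outside j (proj₂ i≺j) j∈))
      where
      outside : ∀ j → m ≤ toℕ j → ¬ (j ∈ₛ supp (v ++ 0ᵛ {n = r}))
      outside j m≤j j∈ = ∈-supp⁻ (v ++ 0ᵛ) j j∈ (trans (lookup-++-≥ v 0ᵛ j m≤j) (lookup-replicate (reduce≥ j m≤j) 0ᶠ))

    saturated-right : ∀ w → IsSaturatedIdeal (Hierarchical m n) (minusOnes m ++ w)
    saturated-right w =
      (λ j i _ i≺j → ∈-supp⁺ (minusOnes m ++ w) i (λ eq → minusOne≢0 (trans (sym (entry i (proj₁ i≺j))) eq))) ,
      (λ j i _ i≺j → trans (cong toℕ (entry i (proj₁ i≺j))) toℕ-[p∸1])
      where
      entry : ∀ i → toℕ i < m → lookup (minusOnes m ++ w) i ≡ [ p ∸ 1 ]ᶠ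
      entry i i<m = trans (lookup-++-< (minusOnes m) w i i<m) (lookup-replicate (fromℕ< i<m) [ p ∸ 1 ]ᶠ)
      minusOne≢0 : [ p ∸ 1 ]ᶠ ≢ 0ᶠ {p}
      minusOne≢0 eq = minusOnes≢0 pr 0 (cong (_∷ []) eq)

    -- An upper element of the support forces full multiplicity on the whole lower level.
    not-saturated : ∀ v w → w ≢ 0ᵛ → v ≢ minusOnes m →
      ¬ (∀ j i → j ∈ₛ supp (v ++ w) → Hierarchical m n i j → toℕ (lookup (v ++ w) i) ≡ p ∸ 1)
    not-saturated v w w≢0 v≢-1 full with j , wj≢0 ← nonzero-coordinate w w≢0 =
      v≢-1 (lookup-constant v [ p ∸ 1 ]ᶠ (λ i → Fin.toℕ-injective (begin
        toℕ (lookup v i)                    ≡⟨ cong toℕ (lookup-++ˡ v w i) ⟨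
        toℕ (lookup (v ++ w) (i ↑ˡ r))      ≡⟨ full (m ↑ʳ j) (i ↑ˡ r) j∈ (i<m i , m≤j) ⟩
        p ∸ 1                               ≡⟨ toℕ-[p∸1] ⟨
        toℕ {p} [ p ∸ 1 ]ᶠ                  ∎)))
      where
      open ≡-Reasoning
      j∈ : (m ↑ʳ j) ∈ₛ supp (v ++ w)
      j∈ = ∈-supp⁺ (v ++ w) (m ↑ʳ j) (λ eq → wj≢0 (trans (sym (lookup-++ʳ v w j)) eq))
      m≤j : m ≤ toℕ (m ↑ʳ j)
      m≤j = subst (m ≤_) (sym (Fin.toℕ-↑ʳ m j)) (m≤m+n m (toℕ j))
      i<m : ∀ i → toℕ (i ↑ˡ r) < m
      i<m i = subst (_< m) (sym (Fin.toℕ-↑ˡ i r)) (Fin.toℕ<n i)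

-- From the weight table to the parameters of the code

-- The order of unnormalised fractions is cross multiplication.
fraction-< : ∀ a b c d .{{_ : NonZero b}} .{{_ : NonZero d}} →
  (ℤ.+ a /ᵘ b) ℚᵘ.< (ℤ.+ c /ᵘ d) → a * d < c * b
fraction-< a (suc b) c (suc d) (*<* lt) =
  ℤ.drop‿+<+ (subst₂ ℤ._<_ (sym (ℤ.pos-* a (suc d))) (sym (ℤ.pos-* c (suc b))) lt)

module _ {p : ℕ} .{{_ : NonZero p}} where

  frequency-∑ : ∀ rows w → frequency {p} rows w ≡ ∑ rows (λ row → proj₂ row * 𝟙 (proj₁ row ≟ w))
  frequency-∑ rows w = trans (∑-filter (λ row → proj₁ row ≟ w) rows proj₂)
    (∑-cong rows (λ row → *-comm (𝟙 (proj₁ row ≟ w)) _))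

  frequency-absent : ∀ rows w → ¬ (w ∈ List.map proj₁ rows) → frequency {p} rows w ≡ 0
  frequency-absent rows w w∉ = trans (frequency-∑ rows w) (absent rows w∉)
    where
    absent : ∀ rows → ¬ (w ∈ List.map proj₁ rows) → ∑ rows (λ row → proj₂ row * 𝟙 (proj₁ row ≟ w)) ≡ 0
    absent []           _  = refl
    absent (row ∷ rows) w∉ = cong₂ _+_
      (trans (cong (proj₂ row *_) (𝟙-no (proj₁ row ≟ w) (λ eq → w∉ (here (sym eq))))) (*-zeroʳ (proj₂ row)))
      (absent rows (w∉ ∘ there))

  frequency≢0⇒∈ : ∀ rows w → frequency {p} rows w ≢ 0 → w ∈ List.map proj₁ rows
  frequency≢0⇒∈ rows w freq≢0 with w ∈? List.map proj₁ rows
    where open import Data.List.Membership.DecPropositional _≟_ using (_∈?_)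
  ... | yes w∈ = w∈
  ... | no w∉  = ⊥-elim (freq≢0 (frequency-absent rows w w∉))

  -- The nonzero weights are the nonzero entries of the table with positive frequency, without repetitions.
  distribution⇒atMost : ∀ {L} {C : Code L} rows → HasWeightDistribution C rows →
                        AtMostNonzeroWeights (length rows) C
  distribution⇒atMost {L} {C} rows dist = length weights ,
    (weights , Unique-filter⁺ occurs? (deduplicate-! (List.map proj₁ rows)) , (λ w → mk⇔ (to w) (from w)) , refl) ,
    (begin
      length weights                                      ≤⟨ length-filter occurs? (deduplicate _≟_ (List.map proj₁ rows)) ⟩
      length (deduplicate _≟_ (List.map proj₁ rows))      ≤⟨ length-deduplicate _≟_ (List.map proj₁ rows) ⟩
      length (List.map proj₁ rows)                        ≡⟨ length-map proj₁ rows ⟩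
      length rows                                         ∎)
    where
    open ≤-Reasoning
    Occurs : ℕ → Set
    Occurs w = w ≢ 0 × frequency {p} rows w ≢ 0
    occurs? : ∀ w → Dec (Occurs w)
    occurs? w = ¬? (w ≟ 0) ×-dec ¬? (frequency {p} rows w ≟ 0)
    weights : List ℕ
    weights = filter occurs? (deduplicate _≟_ (List.map proj₁ rows))

    occurs⇒attained : ∀ w → Occurs w → NonzeroWeight C w
    occurs⇒attained w (w≢0 , freq≢0) with dist w
    ... | []    , _ , _   , eq = ⊥-elim (freq≢0 (sym eq))
    ... | c ∷ _ , _ , iff , _  with c∈C , _ , wt≡w ← Equivalence.to (iff c) (here refl) = w≢0 , c , c∈C , wt≡w

    attained⇒occurs : ∀ w → NonzeroWeight C w → Occurs w
    attained⇒occurs w (w≢0 , c , c∈C , wt≡w) = w≢0 , λ freq≡0 → nonempty freq≡0 (dist w)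
      where
      c≢0 : c ≢ 0ᵛ
      c≢0 refl = w≢0 (trans (sym wt≡w) (wt-0 L))
      nonempty : frequency {p} rows w ≡ 0 → ¬ HasCard (λ c → C c × Nonzero c × wt c ≡ w) (frequency {p} rows w)
      nonempty freq≡0 (xs , _ , iff , len) with xs | Equivalence.from (iff c) (c∈C , c≢0 , wt≡w) | trans len freq≡0
      ... | _ ∷ _ | _ | ()

    to : ∀ w → w ∈ weights → NonzeroWeight C w
    to w w∈ = occurs⇒attained w (proj₂ (∈-filter⁻ occurs? {xs = deduplicate _≟_ (List.map proj₁ rows)} w∈))

    from : ∀ w → NonzeroWeight C w → w ∈ weights
    from w nw with occ ← attained⇒occurs w nw =
      ∈-filter⁺ occurs? (∈-deduplicate⁺ _≟_ (frequency≢0⇒∈ rows w (proj₂ occ))) occ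

  module _ {n : ℕ} (f : Vec (𝔽 p) n → 𝔽 p) (kernel-trivial : ∀ a → encode f a ≡ 0ᵛ → a ≡ 0ᵛ) where

    open IsLinearMap (encode-linear f)

    -- Codewords of one weight are counted by their messages, because the encoding is injective.
    𝒞-distribution : ∀ rows →
      (∀ w → ∑ (allVecs p (suc n)) (λ a → 𝟙 (nonzero? a) * 𝟙 (wt (encode f a) ≟ w)) ≡ frequency {p} rows w) →
      HasWeightDistribution (𝒞 f) rows
    𝒞-distribution rows sums w = codewords , Unique-filter⁺ ofWeight? unique-all ,
      (λ c → mk⇔ (to c) (from c)) , trans count (sums w)
      where
      open ≡-Reasoning
      ofWeight? : ∀ c → Dec (Nonzero c × wt c ≡ w)
      ofWeight? c = nonzero? c ×-dec (wt c ≟ w)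
      all-codewords codewords : List (Vec (𝔽 p) (length (nonzeroVecs p n)))
      all-codewords = List.map (encode f) (allVecs p (suc n))
      codewords     = filter ofWeight? all-codewords
      unique-all = Unique-map⁺ (kernel-trivial⇒injective kernel-trivial) (unique (allVecs-enumerates (suc n)))
      to : ∀ c → c ∈ codewords → 𝒞 f c × Nonzero c × wt c ≡ w
      to c c∈ with c∈all , good ← ∈-filter⁻ ofWeight? {xs = all-codewords} c∈
              with a , _ , refl ← ∈-map⁻ (encode f) c∈all = encode∈𝒞 f a , good
      from : ∀ c → 𝒞 f c × Nonzero c × wt c ≡ w → c ∈ codewords
      from c ((s , u , refl) , good) =
        ∈-filter⁺ ofWeight? (∈-map⁺ (encode f) (complete (allVecs-enumerates (suc n)) (s ∷ u))) good
      count : length codewords ≡ ∑ (allVecs p (suc n)) (λ a → 𝟙 (nonzero? a) * 𝟙 (wt (encode f a) ≟ w))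
      count = begin
        length codewords
          ≡⟨ length-filter-∑ ofWeight? all-codewords ⟩
        ∑ all-codewords (λ c → 𝟙 (ofWeight? c))
          ≡⟨ ∑-map (encode f) (allVecs p (suc n)) _ ⟩
        ∑ (allVecs p (suc n)) (λ a → 𝟙 (ofWeight? (encode f a)))
          ≡⟨ ∑-cong (allVecs p (suc n)) (λ a → trans (𝟙-× (nonzero? (encode f a)) (wt (encode f a) ≟ w))
               (cong (_* 𝟙 (wt (encode f a) ≟ w)) (𝟙-cong (nonzero? (encode f a)) (nonzero? a)
                 (λ ea≢0 a≡0 → ea≢0 (trans (cong (encode f) a≡0) L-0)) (λ a≢0 → a≢0 ∘ kernel-trivial a)))) ⟩
        ∑ (allVecs p (suc n)) (λ a → 𝟙 (nonzero? a) * 𝟙 (wt (encode f a) ≟ w)) ∎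

  -- If d is the least nonzero weight and Q a weight with d p ≤ Q, then for the greatest weight w we have
  -- d p ≤ Q ≤ w ≤ (p - 1) w.
  violates : ∀ {L} {C : Code L} {k} (d Q : ℕ) → 2 ≤ p → HasCard (NonzeroWeight C) k →
    NonzeroWeight C d → (∀ {w} → NonzeroWeight C w → d ≤ w) → NonzeroWeight C Q → d * p ≤ Q →
    ViolatesAshikhminBarg C
  violates {C = C} d Q 2≤p (weights , _ , iff , _) d-attained d-least Q-attained dp≤Q = record
    { w-min = d
    ; w-max = w-max
    ; w-max-nonZero = >-nonZero (≤-trans (n≢0⇒n>0 (proj₁ Q-attained)) Q≤w-max)
    ; isMin = d-attained , d-least
    ; isMax = argmax-all id {P = NonzeroWeight C} {xs = weights} Q-attained
                (All.tabulate (λ {w} → Equivalence.to (iff w))) ,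
              (λ {w} nw → All.lookup (xs≤max Q weights) (Equivalence.from (iff w) nw))
    ; fails = λ lt → <⇒≱ (fraction-< (p ∸ 1) p d w-max {{it}} {{>-nonZero (≤-trans (n≢0⇒n>0 (proj₁ Q-attained)) Q≤w-max)}} lt)
                (begin
                  d * p               ≤⟨ dp≤Q ⟩
                  Q                   ≤⟨ Q≤w-max ⟩
                  w-max               ≡⟨ *-identityˡ w-max ⟨
                  1 * w-max           ≤⟨ *-monoˡ-≤ w-max (∸-monoˡ-≤ 1 2≤p) ⟩
                  (p ∸ 1) * w-max     ∎) }
    where
    open ≤-Reasoning
    w-max : ℕ
    w-max = max Q weights
    Q≤w-max : Q ≤ w-max
    Q≤w-max = ⊥≤max Q weights

  -- The exponents are m = m″ + 2 and r = r″ + 2, and X = p ^ (n - 2) bounds both p ^ m and p ^ r, while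
  -- Q = (p - 1) p X.
  module IdealCode (pr : Prime p) (2<p : 2 < p) {m″ r″ : ℕ}
    {f : Vec (𝔽 p) (suc (suc m″) + suc (suc r″)) → 𝔽 p}
    (ind : IsIdealIndicator (suc (suc m″)) (suc (suc r″)) f) where

    open Weights pr ind
    open Distribution pr ind using (rows; weight-sum)
    open Minimality pr 2<p ind using (𝒞-minimal)

    private
      X d : ℕ
      X = p ^ (m″ + r)
      d = p ^ m + p ^ r ∸ 2

      p^m≤X : p ^ m ≤ X
      p^m≤X = ^-monoʳ-≤ p (begin
        2 + m″            ≡⟨ +-comm 2 m″ ⟩
        m″ + 2            ≤⟨ +-monoʳ-≤ m″ (s≤s (s≤s z≤n)) ⟩
        m″ + r            ∎)
        where open ≤-Reasoning

      p^r≤X : p ^ r ≤ X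
      p^r≤X = ^-monoʳ-≤ p (m≤n+m r m″)

      2≤p∸1 : 2 ≤ p ∸ 1
      2≤p∸1 = ∸-monoˡ-≤ 1 2<p

      p≤p^ : ∀ k → p ≤ p ^ suc k
      p≤p^ k = m≤m*n p (p ^ k) {{m^n≢0 p k}}

      large : p ^ m + p ^ r + p ^ r ≤ Q
      large = begin
        p ^ m + p ^ r + p ^ r     ≤⟨ +-mono-≤ (+-mono-≤ p^m≤X p^r≤X) p^r≤X ⟩
        X + X + X                 ≡⟨ triple X ⟩
        3 * X                     ≤⟨ *-monoˡ-≤ X 2<p ⟩
        p * X                     ≤⟨ m≤n*m (p * X) (p ∸ 1) {{>-nonZero (≤-trans (s≤s z≤n) 2≤p∸1)}} ⟩
        (p ∸ 1) * (p * X)         ∎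
        where
        open ≤-Reasoning
        triple : ∀ x → x + x + x ≡ 3 * x
        triple = solve-∀

      d*p≤Q : d * p ≤ Q
      d*p≤Q = begin
        d * p                     ≤⟨ *-monoˡ-≤ p (m∸n≤m (p ^ m + p ^ r) 2) ⟩
        (p ^ m + p ^ r) * p       ≤⟨ *-monoˡ-≤ p (+-mono-≤ p^m≤X p^r≤X) ⟩
        (X + X) * p               ≡⟨ double X p ⟩
        2 * (p * X)               ≤⟨ *-monoˡ-≤ (p * X) 2≤p∸1 ⟩
        (p ∸ 1) * (p * X)         ∎
        where
        open ≤-Reasoning
        double : ∀ x y → (x + x) * y ≡ 2 * (y * x)
        double = solve-∀

      0<d : 0 < d
      0<d = m<n⇒0<n∸m (≤-trans 2<p (≤-trans (p≤p^ (suc m″)) (m≤m+n (p ^ m) (p ^ r))))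

      0<Q : 0 < Q
      0<Q = ≤-trans (≤-trans (≤-trans (s≤s z≤n) 2<p) (p≤p^ (suc r″))) (≤-trans (m≤n+m (p ^ r) (p ^ m + p ^ r)) large)

      P+R≤Q : p ^ m + p ^ r ≤ Q
      P+R≤Q = m+n≤o⇒m≤o (p ^ m + p ^ r) large

      d-lower : All (d ≤_) (List.map proj₁ rows)
      d-lower =
          ≤-refl
        ∷ ≤-trans (m∸n≤m _ 2) (m+n≤o⇒m≤o∸n (p ^ m + p ^ r) large)
        ∷ ∸-monoˡ-≤ 2 P+R≤Q
        ∷ ∸-mono P+R≤Q (s≤s (z≤n {1}))
        ∷ ≤-trans (m∸n≤m _ 2) P+R≤Q
        ∷ ∸-monoˡ-≤ 2 (≤-trans P+R≤Q (m≤m+n Q (p ^ m)))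
        ∷ ∸-monoˡ-≤ 2 (≤-trans P+R≤Q (m≤m+n Q (p ^ r)))
        ∷ []

      sums : ∀ w → ∑ (allVecs p (suc (m + r))) (λ a → 𝟙 (nonzero? a) * 𝟙 (wt (encode f a) ≟ w)) ≡ frequency {p} rows w
      sums w = trans (weight-sum (λ k → 𝟙 (k ≟ w))) (sym (frequency-∑ rows w))

      -- The weight of a nonzero message has nonzero frequency, so it occurs in the table.
      d≤wt : ∀ a → a ≢ 0ᵛ → d ≤ wt (encode f a)
      d≤wt a a≢0 = All.lookup d-lower (frequency≢0⇒∈ rows w (λ freq≡0 → 1≢0ℕ (begin
        1                                  ≡⟨ cong₂ _*_ (𝟙-yes (nonzero? a) a≢0) (𝟙-yes (w ≟ w) refl) ⟨
        𝟙 (nonzero? a) * 𝟙 (w ≟ w)         ≡⟨ ∑-zero⁻ _ (complete (allVecs-enumerates (suc (m + r))) a) (trans (sums w) freq≡0) ⟩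
        0                                  ∎)))
        where
        open ≡-Reasoning
        w : ℕ
        w = wt (encode f a)
        1≢0ℕ : 1 ≢ 0
        1≢0ℕ ()

      kernel-trivial : ∀ a → encode f a ≡ 0ᵛ → a ≡ 0ᵛ
      kernel-trivial a eq with a ≟ⱽ 0ᵛ
      ... | yes a≡0 = a≡0
      ... | no a≢0  = ⊥-elim (<⇒≱ 0<d (subst (d ≤_) (trans (cong wt eq) (wt-0 (length (nonzeroVecs p (m + r))))) (d≤wt a a≢0)))

      d-message : Vec (𝔽 p) (suc (m + r))
      d-message = 1ᶠ ∷ (0ᵐ ++ 0ʳ)

      wt-d-message : wt (encode f d-message) ≡ d
      wt-d-message = wt-f (1≢0 pr)

      weight≥d : ∀ {w} → NonzeroWeight (𝒞 f) w → d ≤ w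
      weight≥d (w≢0 , _ , (s , u , refl) , refl) = d≤wt (s ∷ u)
        (λ eq → w≢0 (trans (cong (wt ∘ encode f) eq)
          (trans (cong wt (IsLinearMap.L-0 (encode-linear f))) (wt-0 (length (nonzeroVecs p (m + r)))))))

    distribution : HasWeightDistribution (𝒞 f) rows
    distribution = 𝒞-distribution f kernel-trivial rows sums

    code-properties : Is[ p ^ (m + r) ∸ 1 , m + r + 1 , p ^ m + p ^ r ∸ 2 ]Code (𝒞 f) ×
              IsMinimal (𝒞 f) × AtMostNonzeroWeights 7 (𝒞 f) × ViolatesAshikhminBarg (𝒞 f) ×
              HasWeightDistribution (𝒞 f) rows
    code-properties =
      record
        { hasLength   = length-nonzeroVecs (m + r)
        ; linear      = 𝒞-linear f
        ; dimension   = subst (HasDimension (𝒞 f)) (+-comm 1 (m + r)) (𝒞-dimension f kernel-trivial)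
        ; minDistance = 𝒞-minDistance f kernel-trivial d-message (λ eq → 1≢0 pr (proj₁ (∷-injective eq)))
                          wt-d-message d≤wt } ,
      𝒞-minimal ,
      sevenWeights ,
      violates d Q (<⇒≤ 2<p) (proj₁ (proj₂ sevenWeights))
        (n>0⇒n≢0 0<d , encode f d-message , encode∈𝒞 f d-message , wt-d-message)
        weight≥d
        (n>0⇒n≢0 0<Q , codeword f 0ᶠ (minusOnes m ++ 0ʳ) , (0ᶠ , minusOnes m ++ 0ʳ , refl) ,
          wt-linear (minusOnes m) 0ʳ (inj₁ (minusOnes≢0 pr (suc m″))))
        d*p≤Q ,
      distribution
      where
      sevenWeights : AtMostNonzeroWeights 7 (𝒞 f)
      sevenWeights = distribution⇒atMost rows distribution

-- The statement with r as a variable of its own, so that n = m + r can be substituted.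
Claim : (p n m r : ℕ) .{{_ : NonZero p}} → Set
Claim p n m r =
    let Q = (p ∸ 1) * p ^ (n ∸ 1)
        I = fullMultiset p n
        f = χ (λ x → saturatedIdealsIn? (hierarchical? m n) I x ×-dec nonzero? x)
    in
      Is[ p ^ n ∸ 1 , n + 1 , p ^ m + p ^ r ∸ 2 ]Code (𝒞 f) ×
      IsMinimal (𝒞 f) ×
      AtMostNonzeroWeights 7 (𝒞 f) ×
      ViolatesAshikhminBarg (𝒞 f) ×
      HasWeightDistribution (𝒞 f)
        ( (p ^ m + p ^ r ∸ 2 , p ∸ 1)
        ∷ (Q ∸ p ^ r         , (p ∸ 1) * p ^ (m ∸ 1))
        ∷ (Q ∸ 2             , (p ∸ 1) * (p ^ (m ∸ 1) ∸ 1) * (p ^ r ∸ 1))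
        ∷ (Q ∸ 1             , (p ∸ 1) * (p ∸ 2) * p ^ (n ∸ 1))
        ∷ (Q                 , (p ^ n ∸ 1) + (p ∸ 1) * p ^ (m ∸ 1) * (p ^ r ∸ 1))
        ∷ (Q + p ^ m ∸ 2     , (p ∸ 1) * (p ^ r ∸ 1))
        ∷ (Q + p ^ r ∸ 2     , (p ∸ 1) * (p ^ (m ∸ 1) ∸ 1))
        ∷ [])

claim : ∀ {p} .{{_ : NonZero p}} → Prime p → 2 < p → ∀ {n m r} → n ≡ m + r → 2 ≤ m → 2 ≤ r → Claim p n m r
claim {p} pr 2<p {m = suc (suc m″)} {suc (suc r″)} refl (s≤s (s≤s _)) (s≤s (s≤s _)) =
  IdealCode.code-properties pr 2<p {m″} {r″}
    {f = idealIndicator (suc (suc m″)) (suc (suc r″))} (idealIndicator-isIdealIndicator pr (suc (suc m″)) (suc (suc r″)))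

theorem5p4 : (p n m : ℕ) .{{_ : NonZero p}} → Prime p → ¬ (2 ∣ p) → 4 ≤ n → 2 ≤ m → m ≤ n ∸ 2 →
    let r = n ∸ m
        Q = (p ∸ 1) * p ^ (n ∸ 1)
        I = fullMultiset p n
        f = χ (λ x → saturatedIdealsIn? (hierarchical? m n) I x ×-dec nonzero? x)
    in
      Is[ p ^ n ∸ 1 , n + 1 , p ^ m + p ^ r ∸ 2 ]Code (𝒞 f) ×
      IsMinimal (𝒞 f) ×
      AtMostNonzeroWeights 7 (𝒞 f) ×
      ViolatesAshikhminBarg (𝒞 f) ×
      HasWeightDistribution (𝒞 f)
        ( (p ^ m + p ^ r ∸ 2 , p ∸ 1)
        ∷ (Q ∸ p ^ r         , (p ∸ 1) * p ^ (m ∸ 1))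
        ∷ (Q ∸ 2             , (p ∸ 1) * (p ^ (m ∸ 1) ∸ 1) * (p ^ r ∸ 1))
        ∷ (Q ∸ 1             , (p ∸ 1) * (p ∸ 2) * p ^ (n ∸ 1))
        ∷ (Q                 , (p ^ n ∸ 1) + (p ∸ 1) * p ^ (m ∸ 1) * (p ^ r ∸ 1))
        ∷ (Q + p ^ m ∸ 2     , (p ∸ 1) * (p ^ r ∸ 1))
        ∷ (Q + p ^ r ∸ 2     , (p ∸ 1) * (p ^ (m ∸ 1) ∸ 1))
        ∷ [])
theorem5p4 p n m pr 2∤p 4≤n 2≤m m≤n∸2 = claim pr 2<p (sym (m+[n∸m]≡n m≤n)) 2≤m 2≤n∸m
  where
  2<p : 2 < p
  2<p = ≤∧≢⇒< (nonTrivial⇒n>1 p {{prime⇒nonTrivial pr}}) (λ 2≡p → 2∤p (divides 1 (sym 2≡p)))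
  m+2≤n : m + 2 ≤ n
  m+2≤n = subst (m + 2 ≤_) (m∸n+n≡m (≤-trans (s≤s (s≤s z≤n)) 4≤n)) (+-monoˡ-≤ 2 m≤n∸2)
  m≤n : m ≤ n
  m≤n = m+n≤o⇒m≤o m m+2≤n
  2≤n∸m : 2 ≤ n ∸ m
  2≤n∸m = m+n≤o⇒m≤o∸n 2 (subst (_≤ n) (+-comm m 2) m+2≤n)
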